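{- $$\sum_{\pi\in\mathcal{E}_O^{N}}q^{|\pi|}=(-q;q)_\infty\sum_{n\geq0} \frac{q^{2n+1}}{1-q^{2n+1}}\frac{1}{(q^2;q^2)_n}+\frac{1}{(q;q)_\infty}-(-q;q)_\infty .$$
   Context: An overpartition is a finite non-increasing sequence of positive integers (its parts) in which the first occurrence of each number may be overlined (so for each size $t$ at most one part of size $t$ is overlined); the size of a part $t$ or $\overline{t}$ is $t$, and the weight $|\pi|$ is the sum of the sizes of the parts. $\mathcal{E}_O^{N}$ is the set of overpartitions in which at least one non-overlined part appears and the sizes of all non-overlined parts are greater than or equal to the sizes of all overlined parts (if any). Here $|q|<1$ (or $q$ is a formal variable), $(a;q)_\infty=\prod_{i=0}^{\infty}(1-aq^i)$ and $(a;q)_n=\prod_{i=0}^{n-1}(1-aq^i)$. -}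

module Defs where

open import Data.Bool using (Bool; true; false)
open import Data.Integer as ℤ using (ℤ; +_; 0ℤ; 1ℤ)
open import Data.List using (List; length; map)
open import Data.List.Membership.Propositional using (_∈_)
open import Data.List.Relation.Unary.All using (All)
open import Data.List.Relation.Unary.AllPairs using (AllPairs)
open import Data.List.Relation.Unary.Any using (Any)
open import Data.List.Relation.Unary.Linked using (Linked)
open import Data.List.Relation.Unary.Unique.Propositional using (Unique)
open import Data.Nat as ℕ using (ℕ; zero; suc; _∸_; _≤_; _<_; _≥_)
open import Data.Nat.ListAction using (sum)
open import Data.Product using (Σ-syntax; _×_)
open import Function.Bundles using (_⇔_)
open import Level using (Level)
open import Relation.Binary.PropositionalEquality using (_≡_; _≢_)
open import Relation.Unary using (Pred)

private variable
  a ℓ : Level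

record Part : Set where
  constructor part
  field
    size        : ℕ
    isOverlined : Bool

open Part public

Overlined NonOverlined : Part → Set
Overlined    p = isOverlined p ≡ true
NonOverlined p = isOverlined p ≡ false

record IsOverpartition (π : List Part) : Set where
  field
    positive        : All (λ p → 0 < size p) π
    nonIncreasing   : Linked _≥_ (map size π)
    -- An overlined part has a size different from that of every earlier part.
    firstOccurrence : AllPairs (λ p p′ → Overlined p′ → size p ≢ size p′) π

weight : List Part → ℕ
weight π = sum (map size π)

record 𝓔ᴺₒ (π : List Part) : Set where
  field
    isOverpartition : IsOverpartition π
    hasNonOverlined : Any NonOverlined π
    separated       : ∀ {p p′} → p ∈ π → p′ ∈ π →
                      NonOverlined p → Overlined p′ → size p ≥ size p′

-- Formal power series in q with integer coefficients; f n is the coefficient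
-- of qⁿ.
PowerSeries : Set
PowerSeries = ℕ → ℤ

∑≤ : ℕ → (ℕ → ℤ) → ℤ
∑≤ zero    f = f zero
∑≤ (suc n) f = ∑≤ n f ℤ.+ f (suc n)

syntax ∑≤ n (λ i → e) = ∑[ i ≤ n ] e

infixl 6 _+_ _-_
infixl 7 _*_
infixr 8 _^_
infix  8 -_
infix  9 1/_

𝟙 q : PowerSeries
𝟙 zero    = 1ℤ
𝟙 (suc _) = 0ℤ
q zero          = 0ℤ
q (suc zero)    = 1ℤ
q (suc (suc _)) = 0ℤ

_+_ _-_ _*_ : PowerSeries → PowerSeries → PowerSeries
(f + g) n = f n ℤ.+ g n
(f - g) n = f n ℤ.- g n
(f * g) n = ∑[ i ≤ n ] (f i ℤ.* g (n ∸ i))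

-_ : PowerSeries → PowerSeries
(- f) n = ℤ.- f n

_^_ : PowerSeries → ℕ → PowerSeries
f ^ zero  = 𝟙
f ^ suc k = f * f ^ k

-- The sum of the series f 0, f 1, f 2, …, for families in which f k is
-- divisible by qᵏ: only f 0, …, f n then contribute to the coefficient of qⁿ.
∑∞ : (ℕ → PowerSeries) → PowerSeries
∑∞ f n = ∑[ k ≤ n ] f k n

syntax ∑∞ (λ k → e) = ∑[ k ≥0] e

-- The multiplicative inverse of a series f with constant term 1, as the
-- geometric series in 1 - f. The value is meaningless for other f.
1/_ : PowerSeries → PowerSeries
1/ f = ∑[ k ≥0] ((𝟙 - f) ^ k)

-- (x ; b)ₙ = ∏_{0 ≤ i < n} (1 - x bⁱ)
⟨_⨾_⟩_ : PowerSeries → PowerSeries → ℕ → PowerSeries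
⟨ x ⨾ b ⟩ zero  = 𝟙
⟨ x ⨾ b ⟩ suc n = ⟨ x ⨾ b ⟩ n * (𝟙 - x * b ^ n)

-- (x ; b)_∞ for a base b with zero constant term: the factors 1 - x bⁱ with
-- i > n are 1 modulo qⁿ⁺¹, so the coefficient of qⁿ is already that of
-- (x ; b)ₙ₊₁.
⟨_⨾_⟩∞ : PowerSeries → PowerSeries → PowerSeries
⟨ x ⨾ b ⟩∞ n = (⟨ x ⨾ b ⟩ suc n) n

-- ∑_{x ∈ S} q^(w x) = f as formal power series: for each n there are only
-- finitely many x in S with w x = n, and their number is the coefficient of qⁿ
-- in f. The list xs enumerates these x without repetition.
GeneratingFunction : {A : Set a} → Pred A ℓ → (A → ℕ) → PowerSeries → Set _
GeneratingFunction {A = A} S w f =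
  ∀ n → Σ[ xs ∈ List A ]
    Unique xs × (∀ x → x ∈ xs ⇔ (S x × w x ≡ n)) × + length xs ≡ f n

{-# OPTIONS --safe #-}
module Submission where

-- Sort the overpartitions in question, together with those having only overlined
-- parts, by a bound m on the part sizes. Removing the largest part shows that
-- their generating function w satisfies, with d m = (-q; q)ₘ,
--   w (m + 1) = (w m + qᵐ⁺¹ d m) / (1 - qᵐ⁺¹),
-- whence, with x = q²,
--   w ∞ = (-q; q)_∞ (1 + ∑_{m ≥ 1} qᵐ/(1 - qᵐ) · 1/(xᵐ⁺¹; x)_∞).
-- Euler's expansion 1/(xᵐ⁺¹; x)_∞ = ∑ₖ x⁽ᵐ⁺¹⁾ᵏ/(x; x)ₖ and the identity
-- ∑_{m ≥ 1} q⁽²ᵏ⁺¹⁾ᵐ/(1 - qᵐ) = ∑_{j > 2k} qʲ/(1 - qʲ), followed by summation by parts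
-- with ∑_{k ≤ K} xᵏ/(x; x)ₖ = 1/(x; x)_K, turn the sum over m into
-- ∑_{j ≥ 1} qʲ/(1 - qʲ) · 1/(x; x)_⌊(j-1)/2⌋. The odd j give the sum of the theorem
-- and the even j telescope to 1/(x; x)_∞ - 1, where (-q; q)_∞/(x; x)_∞ = 1/(q; q)_∞.
-- Finally the overpartitions without non-overlined parts, counted by (-q; q)_∞, are
-- removed.

import Algebra.Properties.Ring as RingProperties
open import Algebra.Bundles using (CommutativeRing)
import Data.Bool.Properties as Bool
open import Data.Bool using (true; false)
open import Data.Empty using (⊥)
open import Data.Integer as ℤ using (ℤ; +_; 0ℤ; 1ℤ)
import Data.Integer.Properties as ℤ
import Data.Integer.Solver as ℤ
open import Data.List using (List; []; _∷_; _++_; length; map; filter)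
open import Data.List.Membership.Propositional using (_∈_)
open import Data.List.Membership.Propositional.Properties
  using (∈-++⁺ˡ; ∈-++⁺ʳ; ∈-++⁻; ∈-map⁺; ∈-map⁻; ∈-filter⁺; ∈-filter⁻)
open import Data.List.Membership.Propositional.Properties.WithK using (unique∧set⇒bag)
open import Data.List.Properties using (length-++; length-map; ∷-injectiveʳ)
open import Data.List.Relation.Binary.BagAndSetEquality using (∼bag⇒↭)
open import Data.List.Relation.Binary.Permutation.Propositional.Properties using (↭-length)
open import Data.List.Relation.Unary.All as All using (All; []; _∷_)
import Data.List.Relation.Unary.All.Properties as All
open import Data.List.Relation.Unary.AllPairs as AllPairs using (AllPairs; []; _∷_)
import Data.List.Relation.Unary.AllPairs.Properties as AllPairs
open import Data.List.Relation.Unary.Any using (Any; here; there; any?)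
open import Data.List.Relation.Unary.Linked.Properties using (Linked⇒AllPairs; AllPairs⇒Linked)
open import Data.List.Relation.Unary.Unique.Propositional using (Unique)
import Data.List.Relation.Unary.Unique.Propositional.Properties as Unique
import Data.Nat as ℕ
open import Data.Nat using (ℕ; zero; suc; _∸_; _≤_; _<_; _≥_; z≤n; s≤s; s≤s⁻¹)
open import Data.Nat.Induction using (<-rec)
import Data.Nat.Properties as ℕ
import Data.Nat.Solver as ℕ
open import Data.Product using (Σ-syntax; _×_; _,_; proj₁; proj₂)
open import Data.Sum as Sum using (_⊎_; inj₁; inj₂; [_,_]′)
open import Function using (_∘_; id; case_of_; _⇔_; mk⇔; module Equivalence)
open import Function.Properties.Equivalence using () renaming (sym to ⇔-sym; trans to ⇔-trans)
open import Level using (0ℓ)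
open import Relation.Binary.PropositionalEquality as ≡ using (_≡_; _≢_; _≗_; cong; cong₂; subst)
open import Relation.Nullary using (¬_; yes; no; contradiction)
open import Relation.Unary using (Pred; _∪_; _⊆_; _∩_; ∁; Decidable)

open ℕ.+-*-Solver using () renaming (solve to solveℕ; _:+_ to _⊕_; _:*_ to _⊗_; con to κ; _:=_ to _⊜_)

-- Odd and even indices.

odd : ℕ → ℕ
odd k = 2 ℕ.* k ℕ.+ 1

even-odd : ∀ k → 2 ℕ.* suc k ≡ suc (odd k)
even-odd = solveℕ 1 (λ k → κ 2 ⊗ (κ 1 ⊕ k) ⊜ κ 1 ⊕ (κ 2 ⊗ k ⊕ κ 1)) ≡.refl

odd-suc : ∀ k → odd (suc k) ≡ suc (suc (odd k))
odd-suc = solveℕ 1 (λ k → κ 2 ⊗ (κ 1 ⊕ k) ⊕ κ 1 ⊜ κ 2 ⊕ (κ 2 ⊗ k ⊕ κ 1)) ≡.refl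

-- Finite sums and inverses in a commutative ring.

module _ {r ℓ} (R : CommutativeRing r ℓ) where
  open CommutativeRing R
  open import Algebra.Properties.Group +-group using (∙-cancelʳ)
  open import Algebra.Solver.Ring.NaturalCoefficients.Default commutativeSemiring
  open import Relation.Binary.Reasoning.Setoid setoid

  ∑< : ℕ → (ℕ → Carrier) → Carrier
  ∑< zero    f = 0#
  ∑< (suc k) f = ∑< k f + f k

  ∑<-cong : ∀ k {f g} → (∀ i → f i ≈ g i) → ∑< k f ≈ ∑< k g
  ∑<-cong zero    f≈g = refl
  ∑<-cong (suc k) f≈g = +-cong (∑<-cong k f≈g) (f≈g k)

  ∑<-+ : ∀ k f g → ∑< k (λ i → f i + g i) ≈ ∑< k f + ∑< k g
  ∑<-+ zero    f g = sym (+-identityʳ 0#)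
  ∑<-+ (suc k) f g = trans (+-congʳ (∑<-+ k f g))
    (solve 4 (λ a b x y → a :+ b :+ (x :+ y) := a :+ x :+ (b :+ y)) refl _ _ _ _)

  ∑<-*ˡ : ∀ k a f → ∑< k (λ i → a * f i) ≈ a * ∑< k f
  ∑<-*ˡ zero    a f = sym (zeroʳ a)
  ∑<-*ˡ (suc k) a f = trans (+-congʳ (∑<-*ˡ k a f)) (sym (distribˡ a _ _))

  ∑<-zero : ∀ k {f} → (∀ i → f i ≈ 0#) → ∑< k f ≈ 0#
  ∑<-zero zero    f≈0 = refl
  ∑<-zero (suc k) f≈0 = trans (+-cong (∑<-zero k f≈0) (f≈0 k)) (+-identityʳ 0#)

  ∑<-comm : ∀ k l (f : ℕ → ℕ → Carrier) →
            ∑< k (λ i → ∑< l (f i)) ≈ ∑< l (λ j → ∑< k (λ i → f i j))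
  ∑<-comm zero    l f = sym (∑<-zero l (λ _ → refl))
  ∑<-comm (suc k) l f = trans (+-congʳ (∑<-comm k l f)) (sym (∑<-+ l _ _))

  ∑<-head : ∀ k f → ∑< (suc k) f ≈ f 0 + ∑< k (λ i → f (suc i))
  ∑<-head zero    f = +-comm _ _
  ∑<-head (suc k) f = trans (+-congʳ (∑<-head k f)) (+-assoc _ _ _)

  1-a+a : ∀ a → 1# - a + a ≈ 1#
  1-a+a a = begin
    1# - a + a       ≈⟨ +-assoc 1# (- a) a ⟩
    1# + (- a + a)   ≈⟨ +-congˡ (-‿inverseˡ a) ⟩
    1# + 0#          ≈⟨ +-identityʳ 1# ⟩
    1#               ∎

  inverse-* : ∀ {f f⁻¹ g g⁻¹} → f * f⁻¹ ≈ 1# → g * g⁻¹ ≈ 1# → f * g * (g⁻¹ * f⁻¹) ≈ 1#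
  inverse-* {f} {f⁻¹} {g} {g⁻¹} ff⁻¹≈1 gg⁻¹≈1 = begin
    f * g * (g⁻¹ * f⁻¹)
      ≈⟨ solve 4 (λ f f′ g g′ → f :* g :* (g′ :* f′) := f :* f′ :* (g :* g′)) refl f f⁻¹ g g⁻¹ ⟩
    f * f⁻¹ * (g * g⁻¹)   ≈⟨ *-cong ff⁻¹≈1 gg⁻¹≈1 ⟩
    1# * 1#               ≈⟨ *-identityˡ 1# ⟩
    1#                    ∎

  -- Writing 1 as (1 - a) + a turns the inverse of 1 - a into a fixed-point equation without
  -- subtraction.
  1-*-fixpoint : ∀ a v → (1# - a) * v ≈ 1# → v ≈ 1# + a * v
  1-*-fixpoint a v [1-a]v≈1 = begin
    v                         ≈⟨ *-identityˡ v ⟨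
    1# * v                    ≈⟨ *-congʳ (1-a+a a) ⟨
    (1# - a + a) * v          ≈⟨ distribʳ v _ a ⟩
    (1# - a) * v + a * v      ≈⟨ +-congʳ [1-a]v≈1 ⟩
    1# + a * v                ∎

  -- The hypothesis makes v an inverse of 1 - a² = (1 - a)(1 + a). Once a²v is added to both sides,
  -- 1 - a can be combined with a to give 1.
  difference-of-squares-inverse : ∀ a v → v ≈ 1# + a * a * v → (1# - a) * ((1# + a) * v) ≈ 1#
  difference-of-squares-inverse a v v≈ = ∙-cancelʳ (a * a * v) _ _ (begin
    b * ((1# + a) * v) + a * a * v
      ≈⟨ solve 3 (λ a b v → b :* ((con 1 :+ a) :* v) :+ a :* a :* v
            := b :* v :+ a :* v :* (b :+ a)) refl a b v ⟩
    b * v + a * v * (b + a)        ≈⟨ +-congˡ (*-congˡ (1-a+a a)) ⟩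
    b * v + a * v * 1#
      ≈⟨ solve 3 (λ a b v → b :* v :+ a :* v :* con 1 := (b :+ a) :* v) refl a b v ⟩
    (b + a) * v                    ≈⟨ *-congʳ (1-a+a a) ⟩
    1# * v                         ≈⟨ *-identityˡ v ⟩
    v                              ≈⟨ v≈ ⟩
    1# + a * a * v                 ∎)
    where b = 1# - a

  -- Isolates the factor (1 + a) v, which inverts 1 - a when v inverts 1 - a², in the inductive step
  -- of `⟨q⟩-inverse`.
  1+-rearrange : ∀ a d v p → (d + a * d) * (v * p) ≈ (1# + a) * v * (d * p)
  1+-rearrange = solve 4 (λ a d v p → (d :+ a :* d) :* (v :* p) := (con 1 :+ a) :* v :* (d :* p)) refl

  -- The identity modulo qⁿ⁺¹ in an abstract ring.

  -- Intended reading: p i = qⁱ, u i = 1/(1 - qⁱ), P k = 1/(q²; q²)ₖ, d m = (-q; q)ₘ,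
  -- all modulo qⁿ⁺¹, and w m is the generating function of the overpartitions with
  -- non-overlined parts ≥ overlined parts and all parts ≤ m. Inverses enter through u-geometric, in a subtraction-free form that
  -- the semiring solver can handle.
  module TruncatedIdentity
    (n : ℕ) (p u P d w : ℕ → Carrier)
    (p-zero : p 0 ≈ 1#) (p-+ : ∀ i j → p (i ℕ.+ j) ≈ p i * p j)
    (p-nilpotent : p (suc n) ≈ 0#)
    (u-geometric : ∀ i → u (suc i) ≈ 1# + p (suc i) * u (suc i))
    (P-zero : P 0 ≈ 1#) (P-suc : ∀ k → P (suc k) ≈ u (2 ℕ.* suc k) * P k)
    (d-zero : d 0 ≈ 1#) (d-suc : ∀ m → d (suc m) ≈ d m + p (suc m) * d m)
    (w-zero : w 0 ≈ 1#)
    (w-suc : ∀ m → w (suc m) ≈ u (suc m) * w m + p (suc m) * (u (suc m) * d m))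
    where

    private
      N : ℕ
      N = suc n

    p-+-≡ : ∀ {k} i j → k ≡ i ℕ.+ j → p k ≈ p i * p j
    p-+-≡ i j ≡.refl = p-+ i j

    p-vanishes : ∀ i → p (N ℕ.+ i) ≈ 0#
    p-vanishes i = begin
      p (N ℕ.+ i) ≈⟨ p-+ N i ⟩
      p N * p i   ≈⟨ *-congʳ p-nilpotent ⟩
      0# * p i    ≈⟨ zeroˡ _ ⟩
      0#          ∎

    p-vanishes-≡ : ∀ {k} i → k ≡ N ℕ.+ i → p k ≈ 0#
    p-vanishes-≡ i ≡.refl = p-vanishes i

    -- The hypothesis reads (1 - qⁱ⁺¹) a = b. Instead of dividing, c v a is added to both sides;
    -- each then equals v a.
    geometric-unique : ∀ i {a b} → a ≈ b + p (suc i) * a → a ≈ u (suc i) * b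
    geometric-unique i {a} {b} a≈b+ca = ∙-cancelʳ (p (suc i) * (u (suc i) * a)) _ _ (begin
      a + c * (v * a)
        ≈⟨ solve 3 (λ a c v → a :+ c :* (v :* a) := (con 1 :+ c :* v) :* a) refl a c v ⟩
      (1# + c * v) * a             ≈⟨ *-congʳ (u-geometric i) ⟨
      v * a                        ≈⟨ *-congˡ a≈b+ca ⟩
      v * (b + c * a)
        ≈⟨ solve 4 (λ a b c v → v :* (b :+ c :* a) := v :* b :+ c :* (v :* a)) refl a b c v ⟩
      v * b + c * (v * a)          ∎)
      where c = p (suc i)
            v = u (suc i)

    -- The fixed-point equation of `u` applied to the newest factor. It is the difference equation
    -- behind both Euler's expansion and the summation by parts.
    P-step : ∀ k → P (suc k) ≈ P k + p (2 ℕ.* suc k) * P (suc k)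
    P-step k = begin
      P (suc k)                        ≈⟨ P-suc k ⟩
      u 2k * P k                       ≈⟨ *-congʳ (u-geometric _) ⟩
      (1# + p 2k * u 2k) * P k
        ≈⟨ solve 3 (λ a b c → (con 1 :+ a :* b) :* c := c :+ a :* (b :* c)) refl _ _ _ ⟩
      P k + p 2k * (u 2k * P k)        ≈⟨ +-congˡ (*-congˡ (P-suc k)) ⟨
      P k + p 2k * P (suc k)           ∎
      where 2k = 2 ℕ.* suc k

    -- Euler's expansion and its functional equation.

    -- F m is the truncated expansion of 1 / (q²⁽ᵐ⁺¹⁾; q²)_∞ given by Euler's
    -- identity 1 / (z; x)_∞ = ∑ zᵏ / (x; x)ₖ.
    F : ℕ → Carrier
    F m = ∑< N (λ k → p (2 ℕ.* suc m ℕ.* k) * P k)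

    -- With z = q²⁽ᵐ⁺¹⁾ and x = q², this is E(z) = E(zx) + z E(z) for partial sums of E(z) = ∑
    -- zᵏ/(x; x)ₖ. The coefficients of zᵏ⁺¹ agree by `P-step`; multiplication by z raises the
    -- degree, so the last sum is one term shorter.
    F-partial : ∀ m l → ∑< (suc l) (λ k → p (2 ℕ.* suc m ℕ.* k) * P k) ≈
      ∑< (suc l) (λ k → p (2 ℕ.* suc (suc m) ℕ.* k) * P k) +
      p (2 ℕ.* suc m) * ∑< l (λ k → p (2 ℕ.* suc m ℕ.* k) * P k)
    F-partial m zero    = begin
      0# + p (2 ℕ.* suc m ℕ.* 0) * P 0
        ≡⟨ ≡.cong (λ i → 0# + p i * P 0) (≡.trans (ℕ.*-zeroʳ (2 ℕ.* suc m)) (≡.sym (ℕ.*-zeroʳ (2 ℕ.* suc (suc m))))) ⟩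
      0# + p (2 ℕ.* suc (suc m) ℕ.* 0) * P 0 ≈⟨ +-identityʳ _ ⟨
      0# + p (2 ℕ.* suc (suc m) ℕ.* 0) * P 0 + 0# ≈⟨ +-congˡ (zeroʳ _) ⟨
      0# + p (2 ℕ.* suc (suc m) ℕ.* 0) * P 0 + p (2 ℕ.* suc m) * 0# ∎
    F-partial m (suc l) = begin
      S + p (2 ℕ.* suc m ℕ.* suc l) * P (suc l)
        ≈⟨ +-cong (F-partial m l) term ⟩
      S′ + z * S″ + (z * a * P l + b * P (suc l))
        ≈⟨ solve 7 (λ s z t a p b p′ → s :+ z :* t :+ (z :* a :* p :+ b :* p′)
              := (s :+ b :* p′) :+ z :* (t :+ a :* p)) refl S′ z S″ a (P l) b (P (suc l)) ⟩
      (S′ + b * P (suc l)) + z * (S″ + a * P l) ∎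
      where
      S  = ∑< (suc l) (λ k → p (2 ℕ.* suc m ℕ.* k) * P k)
      S′ = ∑< (suc l) (λ k → p (2 ℕ.* suc (suc m) ℕ.* k) * P k)
      S″ = ∑< l (λ k → p (2 ℕ.* suc m ℕ.* k) * P k)
      z  = p (2 ℕ.* suc m)
      a  = p (2 ℕ.* suc m ℕ.* l)
      b  = p (2 ℕ.* suc (suc m) ℕ.* suc l)
      x  = p (2 ℕ.* suc l)
      za≈ : p (2 ℕ.* suc m ℕ.* suc l) ≈ z * a
      za≈ = p-+-≡ _ _ (ℕ.*-suc (2 ℕ.* suc m) l)
      b≈ : b ≈ p (2 ℕ.* suc m ℕ.* suc l) * x
      b≈ = p-+-≡ _ _ (solveℕ 2 (λ m l → κ 2 ⊗ (κ 2 ⊕ m) ⊗ (κ 1 ⊕ l)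
            ⊜ κ 2 ⊗ (κ 1 ⊕ m) ⊗ (κ 1 ⊕ l) ⊕ κ 2 ⊗ (κ 1 ⊕ l)) ≡.refl m l)
      term : p (2 ℕ.* suc m ℕ.* suc l) * P (suc l) ≈ z * a * P l + b * P (suc l)
      term = begin
        p (2 ℕ.* suc m ℕ.* suc l) * P (suc l) ≈⟨ *-congˡ (P-step l) ⟩
        p (2 ℕ.* suc m ℕ.* suc l) * (P l + x * P (suc l)) ≈⟨ distribˡ _ _ _ ⟩
        p (2 ℕ.* suc m ℕ.* suc l) * P l + p (2 ℕ.* suc m ℕ.* suc l) * (x * P (suc l))
          ≈⟨ +-cong (*-congʳ za≈) (sym (trans (*-congʳ b≈) (*-assoc _ _ _))) ⟩
        z * a * P l + b * P (suc l) ∎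

    -- The term that completes the shorter sum in `F-partial` carries the exponent 2(m + 1)(n + 1),
    -- which exceeds n, so it vanishes.
    F-step : ∀ m → F m ≈ F (suc m) + p (2 ℕ.* suc m) * F m
    F-step m = trans (F-partial m n) (+-congˡ (begin
      z * S               ≈⟨ +-identityʳ _ ⟨
      z * S + 0#          ≈⟨ +-congˡ zero-term ⟨
      z * S + z * (a * P n) ≈⟨ distribˡ _ _ _ ⟨
      z * (S + a * P n)   ∎))
      where
      z = p (2 ℕ.* suc m)
      a = p (2 ℕ.* suc m ℕ.* n)
      S = ∑< n (λ k → p (2 ℕ.* suc m ℕ.* k) * P k)
      zero-term : z * (a * P n) ≈ 0#
      zero-term = begin
        z * (a * P n) ≈⟨ *-assoc _ _ _ ⟨
        z * a * P n   ≈⟨ *-congʳ (p-+ _ _) ⟨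
        p (2 ℕ.* suc m ℕ.+ 2 ℕ.* suc m ℕ.* n) * P n
          ≈⟨ *-congʳ (p-vanishes-≡ ((1 ℕ.+ 2 ℕ.* m) ℕ.* suc n)
              (solveℕ 2 (λ m n → κ 2 ⊗ (κ 1 ⊕ m) ⊕ κ 2 ⊗ (κ 1 ⊕ m) ⊗ n
                    ⊜ (κ 1 ⊕ n) ⊕ (κ 1 ⊕ κ 2 ⊗ m) ⊗ (κ 1 ⊕ n)) ≡.refl m n)) ⟩
        0# * P n ≈⟨ zeroˡ _ ⟩
        0# ∎

    -- With a = qᵐ⁺¹, `F-step` reads (1 - a²) F m = F (m + 1); dividing by 1 - a only leaves the
    -- factor 1 + a on the left.
    F-factor : ∀ m → F m + p (suc m) * F m ≈ u (suc m) * F (suc m)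
    F-factor m = geometric-unique m (begin
      F m + a * F m                       ≈⟨ +-congʳ (F-step m) ⟩
      F (suc m) + p (2 ℕ.* suc m) * F m + a * F m
        ≈⟨ +-congʳ (+-congˡ (*-congʳ (p-+-≡ (suc m) (suc m) (≡.cong (suc m ℕ.+_) (ℕ.+-identityʳ (suc m)))))) ⟩
      F (suc m) + a * a * F m + a * F m
        ≈⟨ solve 3 (λ f′ a f → f′ :+ a :* a :* f :+ a :* f := f′ :+ a :* (f :+ a :* f)) refl _ _ _ ⟩
      F (suc m) + a * (F m + a * F m)     ∎)
      where a = p (suc m)

    -- Only k = 0 survives: for k ≥ 1 the exponent 2(N + 1)k exceeds n.
    F-last : F N ≈ 1#
    F-last = begin
      F N ≈⟨ ∑<-head n _ ⟩
      p (2 ℕ.* suc N ℕ.* 0) * P 0 + ∑< n (λ k → p (2 ℕ.* suc N ℕ.* suc k) * P (suc k))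
        ≈⟨ +-cong (*-cong (trans (reflexive (≡.cong p (ℕ.*-zeroʳ (2 ℕ.* suc N)))) p-zero) P-zero)
                  (∑<-zero n (λ k → trans (*-congʳ (vanish k)) (zeroˡ _))) ⟩
      1# * 1# + 0# ≈⟨ solve 0 (con 1 :* con 1 :+ con 0 := con 1) refl ⟩
      1# ∎
      where
      vanish : ∀ k → p (2 ℕ.* suc N ℕ.* suc k) ≈ 0#
      vanish k = p-vanishes-≡ (n ℕ.+ 3 ℕ.+ k ℕ.* (2 ℕ.* suc N))
        (solveℕ 2 (λ n k → κ 2 ⊗ (κ 2 ⊕ n) ⊗ (κ 1 ⊕ k)
              ⊜ (κ 1 ⊕ n) ⊕ (n ⊕ κ 3 ⊕ k ⊗ (κ 2 ⊗ (κ 2 ⊕ n)))) ≡.refl n k)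

    -- Summand i comes from the overpartitions with smallest non-overlined part i + 1,
    -- the last summand F m from those without non-overlined parts.
    smallestPart-sum : ∀ m → w m * F m ≈ d m * (∑< m (λ i → p (suc i) * u (suc i) * F (suc i)) + F m)
    smallestPart-sum zero    = *-cong (trans w-zero (sym d-zero)) (sym (+-identityˡ _))
    smallestPart-sum (suc m) = begin
      w (suc m) * F′                       ≈⟨ *-congʳ (w-suc m) ⟩
      (v * w m + a * (v * d m)) * F′
        ≈⟨ solve 5 (λ v w a d f → (v :* w :+ a :* (v :* d)) :* f
              := w :* (v :* f) :+ a :* v :* d :* f) refl v (w m) a (d m) F′ ⟩
      -- Trading v F′ for (1 + a) F m exposes w m F m for the induction hypothesis; the trade is
      -- undone afterwards.
      w m * (v * F′) + a * v * d m * F′    ≈⟨ +-congʳ (*-congˡ (F-factor m)) ⟨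
      w m * (F m + a * F m) + a * v * d m * F′
        ≈⟨ solve 6 (λ w f a v d f′ → w :* (f :+ a :* f) :+ a :* v :* d :* f′
              := (con 1 :+ a) :* (w :* f) :+ a :* v :* d :* f′) refl (w m) (F m) a v (d m) F′ ⟩
      (1# + a) * (w m * F m) + a * v * d m * F′ ≈⟨ +-congʳ (*-congˡ (smallestPart-sum m)) ⟩
      (1# + a) * (d m * (S + F m)) + a * v * d m * F′
        ≈⟨ solve 6 (λ a d s f v f′ → (con 1 :+ a) :* (d :* (s :+ f)) :+ a :* v :* d :* f′
              := (d :+ a :* d) :* s :+ d :* (f :+ a :* f) :+ a :* v :* d :* f′)
              refl a (d m) S (F m) v F′ ⟩
      (d m + a * d m) * S + d m * (F m + a * F m) + a * v * d m * F′
        ≈⟨ +-congʳ (+-congˡ (*-congˡ (F-factor m))) ⟩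
      (d m + a * d m) * S + d m * (v * F′) + a * v * d m * F′
        ≈⟨ solve 5 (λ a d s v f′ → (d :+ a :* d) :* s :+ d :* (v :* f′) :+ a :* v :* d :* f′
              := (d :+ a :* d) :* (s :+ v :* f′)) refl a (d m) S v F′ ⟩
      -- By v = 1 + a v, the term v F′ splits into the new summand a v F′ and the new remainder F′.
      (d m + a * d m) * (S + v * F′) ≈⟨ *-cong (sym (d-suc m)) (+-congˡ (*-congʳ (u-geometric m))) ⟩
      d (suc m) * (S + (1# + a * v) * F′)
        ≈⟨ *-congˡ (solve 4 (λ s a v f → s :+ (con 1 :+ a :* v) :* f
              := s :+ a :* v :* f :+ f) refl S a v F′) ⟩
      d (suc m) * (S + a * v * F′ + F′) ∎
      where
      F′ = F (suc m)
      a  = p (suc m)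
      v  = u (suc m)
      S  = ∑< m (λ i → p (suc i) * u (suc i) * F (suc i))

    -- Lambert series.

    L : ℕ → Carrier
    L i = p i * u i

    -- G k = ∑_{i ≥ 1} qⁱᵏ / (1 - qⁱ), which by a Lambert series rearrangement is
    -- ∑_{j ≥ k} qʲ / (1 - qʲ).
    G : ℕ → Carrier
    G k = ∑< N (λ i → p (suc i ℕ.* k) * u (suc i))

    -- The geometric series unrolled l times, with its exact remainder.
    L-expansion : ∀ k l → L (suc k) ≈ ∑< l (λ i → p (suc i ℕ.* suc k)) + p (l ℕ.* suc k) * L (suc k)
    L-expansion k zero    = begin
      L (suc k) ≈⟨ solve 1 (λ x → x := con 0 :+ con 1 :* x) refl _ ⟩
      0# + 1# * L (suc k) ≈⟨ +-congˡ (*-congʳ p-zero) ⟨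
      0# + p 0 * L (suc k) ∎
    L-expansion k (suc l) = begin
      L (suc k) ≈⟨ L-expansion k l ⟩
      S + a * (c * v) ≈⟨ +-congˡ (*-congˡ (*-congˡ (u-geometric k))) ⟩
      S + a * (c * (1# + c * v))
        ≈⟨ solve 4 (λ s a c v → s :+ a :* (c :* (con 1 :+ c :* v))
              := s :+ c :* a :+ c :* a :* (c :* v)) refl S a c v ⟩
      S + c * a + c * a * (c * v) ≈⟨ +-cong (+-congˡ (p-+ _ _)) (*-congʳ (p-+ _ _)) ⟨
      S + p (suc l ℕ.* suc k) + p (suc l ℕ.* suc k) * (c * v) ∎
      where
      S = ∑< l (λ i → p (suc i ℕ.* suc k))
      a = p (l ℕ.* suc k)
      c = p (suc k)
      v = u (suc k)

    L-geometric : ∀ k → L (suc k) ≈ ∑< N (λ i → p (suc i ℕ.* suc k))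
    L-geometric k = begin
      L (suc k) ≈⟨ L-expansion k N ⟩
      S + p (N ℕ.* suc k) * L (suc k) ≈⟨ +-congˡ (*-congʳ (p-vanishes-≡ (N ℕ.* k) (ℕ.*-suc N k))) ⟩
      S + 0# * L (suc k) ≈⟨ solve 2 (λ s l → s :+ con 0 :* l := s) refl _ _ ⟩
      S ∎
      where S = ∑< N (λ i → p (suc i ℕ.* suc k))

    -- Termwise qⁱᵏ/(1 - qⁱ) = qⁱᵏ + qⁱ⁽ᵏ⁺¹⁾/(1 - qⁱ); the first summands add up to a Lambert term
    -- by `L-geometric`.
    G-step : ∀ k → G (suc k) ≈ L (suc k) + G (suc (suc k))
    G-step k = begin
      G (suc k) ≈⟨ ∑<-cong N term ⟩
      ∑< N (λ i → p (suc i ℕ.* suc k) + p (suc i ℕ.* suc (suc k)) * u (suc i)) ≈⟨ ∑<-+ N _ _ ⟩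
      ∑< N (λ i → p (suc i ℕ.* suc k)) + G (suc (suc k)) ≈⟨ +-congʳ (L-geometric k) ⟨
      L (suc k) + G (suc (suc k)) ∎
      where
      term : ∀ i → p (suc i ℕ.* suc k) * u (suc i) ≈ p (suc i ℕ.* suc k) + p (suc i ℕ.* suc (suc k)) * u (suc i)
      term i = begin
        a * v              ≈⟨ *-congˡ (u-geometric i) ⟩
        a * (1# + c * v)
          ≈⟨ solve 3 (λ a c v → a :* (con 1 :+ c :* v) := a :+ (c :* a) :* v) refl a c v ⟩
        a + (c * a) * v    ≈⟨ +-congˡ (*-congʳ (p-+-≡ _ _ (ℕ.*-suc (suc i) (suc k)))) ⟨
        a + p (suc i ℕ.* suc (suc k)) * v ∎
        where
        a = p (suc i ℕ.* suc k)
        c = p (suc i)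
        v = u (suc i)

    G-vanishes : ∀ k → G (N ℕ.+ k) ≈ 0#
    G-vanishes k = ∑<-zero N (λ i → trans (*-congʳ (p-vanishes-≡ (k ℕ.+ i ℕ.* (N ℕ.+ k)) (ℕ.+-assoc N k _))) (zeroˡ _))

    -- Two applications of `G-step` keep the argument odd and split off one odd and one even Lambert
    -- term.
    G-odd : ∀ k → G (odd k) ≈ L (odd k) + (L (2 ℕ.* suc k) + G (odd (suc k)))
    G-odd k = begin
      G (odd k)         ≡⟨ ≡.cong G (ℕ.+-comm _ 1) ⟩
      G (suc j)         ≈⟨ G-step j ⟩
      L (suc j) + G (suc (suc j)) ≈⟨ +-congˡ (G-step (suc j)) ⟩
      L (suc j) + (L (suc (suc j)) + G (suc (suc (suc j))))
        ≡⟨ ≡.cong₂ _+_ (≡.cong L j+1)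
           (≡.cong₂ _+_ (≡.cong L (≡.trans (≡.cong suc j+1) (≡.sym (even-odd k))))
             (≡.cong G (≡.trans (≡.cong (λ i → suc (suc i)) j+1) (≡.sym (odd-suc k))))) ⟩
      L (odd k) + (L (2 ℕ.* suc k) + G (odd (suc k))) ∎
      where
      j = 2 ℕ.* k
      j+1 : suc j ≡ odd k
      j+1 = ℕ.+-comm 1 j

    -- The form of `P-step` through which the even Lambert terms telescope in `abel`.
    P-step-L : ∀ k → P (suc k) ≈ P k + L (2 ℕ.* suc k) * P k
    P-step-L k = begin
      P (suc k)         ≈⟨ P-step k ⟩
      P k + x * P (suc k) ≈⟨ +-congˡ (*-congˡ (P-suc k)) ⟩
      P k + x * (u (2 ℕ.* suc k) * P k) ≈⟨ +-congˡ (*-assoc _ _ _) ⟨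
      P k + L (2 ℕ.* suc k) * P k ∎
      where x = p (2 ℕ.* suc k)

    -- Abel summation, using P k - P (k - 1) = q²ᵏ P k and
    -- G (2k + 1) = L (2k + 1) + L (2k + 2) + G (2k + 3).
    abel : ∀ k → ∑< (suc k) (λ i → p (2 ℕ.* i) * P i * G (odd i)) + 1# ≈
                 ∑< (suc k) (λ i → L (odd i) * P i) + P (suc k) + P k * G (odd (suc k))
    abel zero    = begin
      0# + p 0 * P 0 * G 1 + 1# ≈⟨ +-cong (+-congˡ (*-congʳ (*-congʳ p-zero))) (sym P-zero) ⟩
      0# + 1# * P 0 * G 1 + P 0 ≈⟨ +-congʳ (+-congˡ (*-congˡ (G-odd 0))) ⟩
      0# + 1# * P 0 * (L 1 + (L 2 + G 3)) + P 0
        ≈⟨ solve 4 (λ p a b g → con 0 :+ con 1 :* p :* (a :+ (b :+ g)) :+ p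
              := con 0 :+ a :* p :+ (p :+ b :* p) :+ p :* g) refl (P 0) (L 1) (L 2) (G 3) ⟩
      0# + L 1 * P 0 + (P 0 + L 2 * P 0) + P 0 * G 3 ≈⟨ +-congʳ (+-congˡ (P-step-L 0)) ⟨
      0# + L 1 * P 0 + P 1 + P 0 * G 3 ∎
    abel (suc k) = begin
      S + x * P′ * g + 1#
        ≈⟨ solve 4 (λ s x p g → s :+ x :* p :* g :+ con 1 := s :+ con 1 :+ x :* p :* g) refl S x P′ g ⟩
      S + 1# + x * P′ * g ≈⟨ +-congʳ (abel k) ⟩
      T + P′ + P k * g + x * P′ * g
        ≈⟨ solve 5 (λ t p′ p g x → t :+ p′ :+ p :* g :+ x :* p′ :* g
              := t :+ p′ :+ (p :+ x :* p′) :* g) refl T P′ (P k) g x ⟩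
      -- The old boundary term and the new summand combine, since P k + x P′ = P′.
      T + P′ + (P k + x * P′) * g ≈⟨ +-congˡ (*-cong (P-step k) (sym (G-odd (suc k)))) ⟨
      T + P′ + P′ * (L (odd (suc k)) + (L (2 ℕ.* suc (suc k)) + G (odd (suc (suc k)))))
        ≈⟨ solve 5 (λ t p a b g → t :+ p :+ p :* (a :+ (b :+ g))
              := t :+ a :* p :+ (p :+ b :* p) :+ p :* g) refl T P′ _ _ _ ⟩
      T + L (odd (suc k)) * P′ + (P′ + L (2 ℕ.* suc (suc k)) * P′) + P′ * G (odd (suc (suc k)))
        ≈⟨ +-congʳ (+-congˡ (P-step-L (suc k))) ⟨
      T + L (odd (suc k)) * P′ + P (suc (suc k)) + P′ * G (odd (suc (suc k))) ∎
      where
      S  = ∑< (suc k) (λ i → p (2 ℕ.* i) * P i * G (odd i))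
      T  = ∑< (suc k) (λ i → L (odd i) * P i)
      x  = p (2 ℕ.* suc k)
      P′ = P (suc k)
      g  = G (odd (suc k))

    -- Euler's expansion is inserted and the sums are interchanged. The exponents regroup by (i + 1)
    -- + 2(i + 2)k = 2k + (i + 1)(2k + 1), so that the inner sum becomes `G (odd k)`.
    double-sum : ∑< N (λ i → p (suc i) * u (suc i) * F (suc i)) ≈
                 ∑< N (λ k → p (2 ℕ.* k) * P k * G (odd k))
    double-sum = begin
      ∑< N (λ i → L (suc i) * F (suc i)) ≈⟨ ∑<-cong N (λ i → ∑<-*ˡ N _ _) ⟨
      ∑< N (λ i → ∑< N (λ k → L (suc i) * (p (2 ℕ.* suc (suc i) ℕ.* k) * P k))) ≈⟨ ∑<-comm N N _ ⟩
      ∑< N (λ k → ∑< N (λ i → L (suc i) * (p (2 ℕ.* suc (suc i) ℕ.* k) * P k)))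
        ≈⟨ ∑<-cong N (λ k → ∑<-cong N (λ i → term i k)) ⟩
      ∑< N (λ k → ∑< N (λ i → p (2 ℕ.* k) * P k * (p (suc i ℕ.* odd k) * u (suc i))))
        ≈⟨ ∑<-cong N (λ k → ∑<-*ˡ N _ _) ⟩
      ∑< N (λ k → p (2 ℕ.* k) * P k * G (odd k)) ∎
      where
      exponents : ∀ i k → p (suc i) * p (2 ℕ.* suc (suc i) ℕ.* k) ≈ p (2 ℕ.* k) * p (suc i ℕ.* odd k)
      exponents i k = begin
        p (suc i) * p (2 ℕ.* suc (suc i) ℕ.* k) ≈⟨ p-+ _ _ ⟨
        p (suc i ℕ.+ 2 ℕ.* suc (suc i) ℕ.* k)
          ≈⟨ p-+-≡ _ _ (solveℕ 2 (λ i k → (κ 1 ⊕ i) ⊕ κ 2 ⊗ (κ 2 ⊕ i) ⊗ k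
                ⊜ κ 2 ⊗ k ⊕ (κ 1 ⊕ i) ⊗ (κ 2 ⊗ k ⊕ κ 1)) ≡.refl i k) ⟩
        p (2 ℕ.* k) * p (suc i ℕ.* odd k) ∎
      term : ∀ i k → L (suc i) * (p (2 ℕ.* suc (suc i) ℕ.* k) * P k) ≈
                     p (2 ℕ.* k) * P k * (p (suc i ℕ.* odd k) * u (suc i))
      term i k = begin
        a * v * (b * P k)
          ≈⟨ solve 4 (λ a v b p → a :* v :* (b :* p) := a :* b :* (v :* p)) refl a v b (P k) ⟩
        a * b * (v * P k) ≈⟨ *-congʳ (exponents i k) ⟩
        x * y * (v * P k)
          ≈⟨ solve 4 (λ x y v p → x :* y :* (v :* p) := x :* p :* (y :* v)) refl x y v (P k) ⟩
        x * P k * (y * v) ∎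
        where
        a = p (suc i)
        b = p (2 ℕ.* suc (suc i) ℕ.* k)
        v = u (suc i)
        x = p (2 ℕ.* k)
        y = p (suc i ℕ.* odd k)

    identity : w N ≈ d N * ∑< N (λ k → p (odd k) * u (odd k) * P k) + d N * P N
    identity = begin
      w N ≈⟨ *-identityʳ _ ⟨
      w N * 1# ≈⟨ *-congˡ F-last ⟨
      w N * F N ≈⟨ smallestPart-sum N ⟩
      d N * (∑< N (λ i → L (suc i) * F (suc i)) + F N) ≈⟨ *-congˡ (+-cong double-sum F-last) ⟩
      d N * (∑< N (λ k → p (2 ℕ.* k) * P k * G (odd k)) + 1#) ≈⟨ *-congˡ (abel n) ⟩
      d N * (T + P N + P n * G (odd N))
        -- The boundary term of the summation by parts vanishes because odd N ≥ N.
        ≈⟨ *-congˡ (+-congˡ (*-congˡ (trans (reflexive (≡.cong G odd-N)) (G-vanishes (N ℕ.+ 1))))) ⟩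
      d N * (T + P N + P n * 0#)
        ≈⟨ solve 4 (λ d t p p′ → d :* (t :+ p :+ p′ :* con 0)
              := d :* t :+ d :* p) refl (d N) T (P N) (P n) ⟩
      d N * T + d N * P N ∎
      where
      T = ∑< N (λ k → L (odd k) * P k)
      odd-N : odd N ≡ N ℕ.+ (N ℕ.+ 1)
      odd-N = ≡.trans (≡.cong (λ i → N ℕ.+ i ℕ.+ 1) (ℕ.+-identityʳ N)) (ℕ.+-assoc N N 1)

open import Defs
open ≡ using (refl; sym; trans)
open ≡.≡-Reasoning
open Equivalence using (to; from)
open ℤ.+-*-Solver using () renaming (solve to solveℤ; _:+_ to _⊞_; _:*_ to _⊠_; :-_ to ⊟_; _:=_ to _≔_)

-- Convolution of coefficient sequences.

∑≤-cong : ∀ n {f g} → (∀ i → i ≤ n → f i ≡ g i) → ∑≤ n f ≡ ∑≤ n g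
∑≤-cong zero    f≡g = f≡g 0 z≤n
∑≤-cong (suc n) f≡g =
  cong₂ ℤ._+_ (∑≤-cong n (λ i i≤n → f≡g i (ℕ.m≤n⇒m≤1+n i≤n))) (f≡g (suc n) ℕ.≤-refl)

∑≤-zero : ∀ n {f} → (∀ i → i ≤ n → f i ≡ 0ℤ) → ∑≤ n f ≡ 0ℤ
∑≤-zero zero    f≡0 = f≡0 0 z≤n
∑≤-zero (suc n) f≡0 =
  cong₂ ℤ._+_ (∑≤-zero n (λ i i≤n → f≡0 i (ℕ.m≤n⇒m≤1+n i≤n))) (f≡0 (suc n) ℕ.≤-refl)

∑≤-head : ∀ n f → ∑≤ (suc n) f ≡ f 0 ℤ.+ ∑≤ n (f ∘ suc)
∑≤-head zero    f = refl
∑≤-head (suc n) f = trans (cong (ℤ._+ f (suc (suc n))) (∑≤-head n f)) (ℤ.+-assoc (f 0) _ _)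

∑≤-extend : ∀ {n} m {f} → (∀ k → n < k → f k ≡ 0ℤ) → ∑≤ (m ℕ.+ n) f ≡ ∑≤ n f
∑≤-extend zero    f≡0 = refl
∑≤-extend {n} (suc m) {f} f≡0 = begin
  ∑≤ (m ℕ.+ n) f ℤ.+ f (suc (m ℕ.+ n))
    ≡⟨ cong₂ ℤ._+_ (∑≤-extend m f≡0) (f≡0 _ (s≤s (ℕ.m≤n+m n m))) ⟩
  ∑≤ n f ℤ.+ 0ℤ                        ≡⟨ ℤ.+-identityʳ _ ⟩
  ∑≤ n f                               ∎

tail : PowerSeries → PowerSeries
tail f n = f (suc n)

*-head : ∀ f g n → (f * g) (suc n) ≡ f 0 ℤ.* g (suc n) ℤ.+ (tail f * g) n
*-head f g n = ∑≤-head n (λ i → f i ℤ.* g (suc n ∸ i))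

*-last : ∀ f g n → (f * g) (suc n) ≡ (f * tail g) n ℤ.+ f (suc n) ℤ.* g 0
*-last f g n = cong₂ ℤ._+_
  (∑≤-cong n (λ i i≤n → cong (λ k → f i ℤ.* g k) (ℕ.+-∸-assoc 1 i≤n)))
  (cong (λ k → f (suc n) ℤ.* g k) (ℕ.n∸n≡0 n))

-- The term containing f 0 is first in f * g and last in g * f; removing it replaces f by `tail f`
-- and lowers n.
*-comm : ∀ f g → f * g ≗ g * f
*-comm f g zero    = ℤ.*-comm (f 0) (g 0)
*-comm f g (suc n) = begin
  (f * g) (suc n)                          ≡⟨ *-head f g n ⟩
  f 0 ℤ.* g (suc n) ℤ.+ (tail f * g) n     ≡⟨ cong₂ ℤ._+_ (ℤ.*-comm (f 0) _) (*-comm (tail f) g n) ⟩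
  g (suc n) ℤ.* f 0 ℤ.+ (g * tail f) n     ≡⟨ ℤ.+-comm (g (suc n) ℤ.* f 0) _ ⟩
  (g * tail f) n ℤ.+ g (suc n) ℤ.* f 0     ≡⟨ *-last g f n ⟨
  (g * f) (suc n)                          ∎

*-distribʳ-+ : ∀ f g h → (g + h) * f ≗ g * f + h * f
*-distribʳ-+ f g h zero    = ℤ.*-distribʳ-+ (f 0) (g 0) (h 0)
*-distribʳ-+ f g h (suc n) = begin
  ((g + h) * f) (suc n)
    ≡⟨ *-head (g + h) f n ⟩
  (g 0 ℤ.+ h 0) ℤ.* f (suc n) ℤ.+ ((tail g + tail h) * f) n
    ≡⟨ cong (λ z → (g 0 ℤ.+ h 0) ℤ.* f (suc n) ℤ.+ z) (*-distribʳ-+ f (tail g) (tail h) n) ⟩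
  (g 0 ℤ.+ h 0) ℤ.* f (suc n) ℤ.+ ((tail g * f) n ℤ.+ (tail h * f) n)
    ≡⟨ solveℤ 5 (λ a b c x y → (a ⊞ b) ⊠ c ⊞ (x ⊞ y)
          ≔ (a ⊠ c ⊞ x) ⊞ (b ⊠ c ⊞ y)) refl (g 0) (h 0) (f (suc n)) _ _ ⟩
  (g 0 ℤ.* f (suc n) ℤ.+ (tail g * f) n) ℤ.+ (h 0 ℤ.* f (suc n) ℤ.+ (tail h * f) n)
    ≡⟨ cong₂ ℤ._+_ (*-head g f n) (*-head h f n) ⟨
  (g * f + h * f) (suc n) ∎

*-scaleˡ : ∀ a g h n → ((λ i → a ℤ.* g i) * h) n ≡ a ℤ.* (g * h) n
*-scaleˡ a g h zero    = ℤ.*-assoc a (g 0) (h 0)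
*-scaleˡ a g h (suc n) = begin
  ((λ i → a ℤ.* g i) * h) (suc n)
    ≡⟨ *-head (λ i → a ℤ.* g i) h n ⟩
  a ℤ.* g 0 ℤ.* h (suc n) ℤ.+ ((λ i → a ℤ.* tail g i) * h) n
    ≡⟨ cong₂ ℤ._+_ (ℤ.*-assoc a (g 0) _) (*-scaleˡ a (tail g) h n) ⟩
  a ℤ.* (g 0 ℤ.* h (suc n)) ℤ.+ a ℤ.* (tail g * h) n
    ≡⟨ ℤ.*-distribˡ-+ a _ _ ⟨
  a ℤ.* (g 0 ℤ.* h (suc n) ℤ.+ (tail g * h) n)
    ≡⟨ cong (a ℤ.*_) (*-head g h n) ⟨
  a ℤ.* (g * h) (suc n) ∎

-- Congruence modulo qᴺ and the truncated ring.

infix 4 _≈[_]_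

-- Congruence modulo q ^ N.
_≈[_]_ : PowerSeries → ℕ → PowerSeries → Set
f ≈[ N ] g = ∀ n → n < N → f n ≡ g n

𝟘 : PowerSeries
𝟘 _ = 0ℤ

*-cong : ∀ {N f f′ g g′} → f ≈[ N ] f′ → g ≈[ N ] g′ → f * g ≈[ N ] f′ * g′
*-cong f≈f′ g≈g′ n n<N = ∑≤-cong n (λ i i≤n →
  cong₂ ℤ._*_ (f≈f′ i (ℕ.≤-<-trans i≤n n<N)) (g≈g′ (n ∸ i) (ℕ.≤-<-trans (ℕ.m∸n≤m n i) n<N)))

*-≗ˡ : ∀ f {g g′} → g ≗ g′ → f * g ≗ f * g′
*-≗ˡ f g≗g′ n = ∑≤-cong n (λ i _ → cong (f i ℤ.*_) (g≗g′ (n ∸ i)))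

*-≗ʳ : ∀ g {f f′} → f ≗ f′ → f * g ≗ f′ * g
*-≗ʳ g f≗f′ n = ∑≤-cong n (λ i _ → cong (ℤ._* g (n ∸ i)) (f≗f′ i))

-- Induction on n by the rule tail (f * g) = f 0 · tail g + tail f * g.
*-assoc : ∀ f g h → (f * g) * h ≗ f * (g * h)
*-assoc f g h zero    = ℤ.*-assoc (f 0) (g 0) (h 0)
*-assoc f g h (suc n) = begin
  ((f * g) * h) (suc n)
    ≡⟨ *-head (f * g) h n ⟩
  f 0 ℤ.* g 0 ℤ.* h (suc n) ℤ.+ (tail (f * g) * h) n
    ≡⟨ cong (λ z → f 0 ℤ.* g 0 ℤ.* h (suc n) ℤ.+ z) (begin
      (tail (f * g) * h) n
        ≡⟨ *-≗ʳ h (*-head f g) n ⟩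
      (((λ i → f 0 ℤ.* tail g i) + tail f * g) * h) n
        ≡⟨ *-distribʳ-+ h (λ i → f 0 ℤ.* tail g i) (tail f * g) n ⟩
      ((λ i → f 0 ℤ.* tail g i) * h) n ℤ.+ ((tail f * g) * h) n
        ≡⟨ cong₂ ℤ._+_ (*-scaleˡ (f 0) (tail g) h n) (*-assoc (tail f) g h n) ⟩
      f 0 ℤ.* (tail g * h) n ℤ.+ (tail f * (g * h)) n ∎) ⟩
  f 0 ℤ.* g 0 ℤ.* h (suc n) ℤ.+ (f 0 ℤ.* (tail g * h) n ℤ.+ (tail f * (g * h)) n)
    ≡⟨ solveℤ 5 (λ a b c x y → a ⊠ b ⊠ c ⊞ (a ⊠ x ⊞ y)
          ≔ a ⊠ (b ⊠ c ⊞ x) ⊞ y) refl (f 0) (g 0) (h (suc n)) _ _ ⟩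
  f 0 ℤ.* (g 0 ℤ.* h (suc n) ℤ.+ (tail g * h) n) ℤ.+ (tail f * (g * h)) n
    ≡⟨ cong (λ z → f 0 ℤ.* z ℤ.+ (tail f * (g * h)) n) (*-head g h n) ⟨
  f 0 ℤ.* (g * h) (suc n) ℤ.+ (tail f * (g * h)) n
    ≡⟨ *-head f (g * h) n ⟨
  (f * (g * h)) (suc n) ∎

-- If i + j < a + b, then i < a or j < b, so each summand has a vanishing factor.
*-order : ∀ {a b f g} → f ≈[ a ] 𝟘 → g ≈[ b ] 𝟘 → f * g ≈[ a ℕ.+ b ] 𝟘
*-order {a} {b} {f} {g} f≈0 g≈0 n n<a+b = ∑≤-zero n vanish
  where
  vanish : ∀ i → i ≤ n → f i ℤ.* g (n ∸ i) ≡ 0ℤ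
  vanish i i≤n with ℕ.<-≤-connex i a
  ... | inj₁ i<a = cong (ℤ._* g (n ∸ i)) (f≈0 i i<a)
  ... | inj₂ a≤i = trans (cong (f i ℤ.*_) (g≈0 (n ∸ i) n∸i<b)) (ℤ.*-zeroʳ (f i))
    where
    n∸i<b : n ∸ i < b
    n∸i<b = ≡.subst (n ∸ i <_) (ℕ.m+n∸m≡n i b)
              (ℕ.∸-monoˡ-< (ℕ.<-≤-trans n<a+b (ℕ.+-monoˡ-≤ b a≤i)) i≤n)

*-identityˡ : ∀ f → 𝟙 * f ≗ f
*-identityˡ f zero    = ℤ.*-identityˡ (f 0)
*-identityˡ f (suc n) = begin
  (𝟙 * f) (suc n)                    ≡⟨ *-head 𝟙 f n ⟩
  1ℤ ℤ.* f (suc n) ℤ.+ (𝟘 * f) n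
    ≡⟨ cong₂ ℤ._+_ (ℤ.*-identityˡ (f (suc n))) (∑≤-zero n (λ _ _ → refl)) ⟩
  f (suc n) ℤ.+ 0ℤ                   ≡⟨ ℤ.+-identityʳ (f (suc n)) ⟩
  f (suc n)                          ∎

*-identityʳ : ∀ f → f * 𝟙 ≗ f
*-identityʳ f n = trans (*-comm f 𝟙 n) (*-identityˡ f n)

-- The quotient modulo qᴺ as a setoid: the elements stay full series and only equality is coarsened,
-- which makes q nilpotent.
truncatedRing : ℕ → CommutativeRing 0ℓ 0ℓ
truncatedRing N = record
  { Carrier = PowerSeries ; _≈_ = _≈[ N ]_ ; _+_ = _+_ ; _*_ = _*_ ; -_ = -_ ; 0# = 𝟘 ; 1# = 𝟙
  ; isCommutativeRing = record
    { *-comm = λ f g n _ → *-comm f g n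
    ; isRing = record
      { +-isAbelianGroup = record
        { comm = λ f g n _ → ℤ.+-comm (f n) (g n)
        ; isGroup = record
          { inverse = (λ f n _ → ℤ.+-inverseˡ (f n)) , (λ f n _ → ℤ.+-inverseʳ (f n))
          ; ⁻¹-cong = λ f≈g n n<N → cong ℤ.-_ (f≈g n n<N)
          ; isMonoid = record
            { identity = (λ f n _ → ℤ.+-identityˡ (f n)) , (λ f n _ → ℤ.+-identityʳ (f n))
            ; isSemigroup = record
              { assoc = λ f g h n _ → ℤ.+-assoc (f n) (g n) (h n)
              ; isMagma = record
                { ∙-cong = λ f≈g h≈k n n<N → cong₂ ℤ._+_ (f≈g n n<N) (h≈k n n<N)
                ; isEquivalence = record
                  { refl  = λ _ _ → refl
                  ; sym   = λ f≈g n n<N → sym (f≈g n n<N)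
                  ; trans = λ f≈g g≈h n n<N → trans (f≈g n n<N) (g≈h n n<N)
                  }
                }
              }
            }
          }
        }
      ; *-cong     = *-cong
      ; *-assoc    = λ f g h n _ → *-assoc f g h n
      ; *-identity = (λ f n _ → *-identityˡ f n) , (λ f n _ → *-identityʳ f n)
      ; distrib    = (λ f g h n _ → distribˡ f g h n) , (λ f g h n _ → *-distribʳ-+ f g h n)
      }
    }
  }
  where
  distribˡ : ∀ f g h → f * (g + h) ≗ f * g + f * h
  distribˡ f g h n = begin
    (f * (g + h)) n         ≡⟨ *-comm f (g + h) n ⟩
    ((g + h) * f) n         ≡⟨ *-distribʳ-+ f g h n ⟩
    (g * f) n ℤ.+ (h * f) n ≡⟨ cong₂ ℤ._+_ (*-comm g f n) (*-comm h f n) ⟩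
    (f * g + f * h) n       ∎

-- A pointwise identity is read off in the ring modulo qⁿ⁺¹, which still sees coefficient n.
neg-*ˡ : ∀ f g → (- f) * g ≗ - (f * g)
neg-*ˡ f g n = sym (RingProperties.-‿distribˡ-* (CommutativeRing.ring (truncatedRing (suc n))) f g n ℕ.≤-refl)

-- Orders of vanishing and powers of q.

≈-weaken : ∀ {M N f g} → M ≤ N → f ≈[ N ] g → f ≈[ M ] g
≈-weaken M≤N f≈g n n<M = f≈g n (ℕ.<-≤-trans n<M M≤N)

≈-*-zeroʳ : ∀ {N} f {g} → g ≈[ N ] 𝟘 → f * g ≈[ N ] 𝟘
≈-*-zeroʳ f g≈0 = *-order {0} {f = f} (λ _ ()) g≈0

^-order : ∀ {f} → f ≈[ 1 ] 𝟘 → ∀ k → f ^ k ≈[ k ] 𝟘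
^-order f≈0 zero    n ()
^-order f≈0 (suc k) = *-order f≈0 (^-order f≈0 k)

^-+ : ∀ f i j → f ^ (i ℕ.+ j) ≗ f ^ i * f ^ j
^-+ f zero    j n = sym (*-identityˡ (f ^ j) n)
^-+ f (suc i) j n = trans (*-≗ˡ f (^-+ f i j) n) (sym (*-assoc f (f ^ i) (f ^ j) n))

^-* : ∀ f i j → (f ^ i) ^ j ≗ f ^ (i ℕ.* j)
^-* f i zero    n = cong (λ k → (f ^ k) n) (sym (ℕ.*-zeroʳ i))
^-* f i (suc j) n = begin
  (f ^ i * (f ^ i) ^ j) n ≡⟨ *-≗ˡ (f ^ i) (^-* f i j) n ⟩
  (f ^ i * f ^ (i ℕ.* j)) n ≡⟨ ^-+ f i (i ℕ.* j) n ⟨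
  (f ^ (i ℕ.+ i ℕ.* j)) n ≡⟨ cong (λ k → (f ^ k) n) (ℕ.*-suc i j) ⟨
  (f ^ (i ℕ.* suc j)) n ∎

q-order : q ≈[ 1 ] 𝟘
q-order zero _ = refl
q-order (suc n) (s≤s ())

tail-q : tail q ≗ 𝟙
tail-q zero    = refl
tail-q (suc n) = refl

q*-suc : ∀ f n → (q * f) (suc n) ≡ f n
q*-suc f n = begin
  (q * f) (suc n)                  ≡⟨ *-head q f n ⟩
  0ℤ ℤ.* f (suc n) ℤ.+ (tail q * f) n ≡⟨ ℤ.+-identityˡ _ ⟩
  (tail q * f) n                   ≡⟨ *-≗ʳ f tail-q n ⟩
  (𝟙 * f) n                        ≡⟨ *-identityˡ f n ⟩
  f n                              ∎

q^*-shift : ∀ m f n → (q ^ m * f) (m ℕ.+ n) ≡ f n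
q^*-shift zero    f n = *-identityˡ f n
q^*-shift (suc m) f n = begin
  (q * q ^ m * f) (suc m ℕ.+ n)   ≡⟨ *-assoc q (q ^ m) f (suc m ℕ.+ n) ⟩
  (q * (q ^ m * f)) (suc m ℕ.+ n) ≡⟨ q*-suc (q ^ m * f) (m ℕ.+ n) ⟩
  (q ^ m * f) (m ℕ.+ n)           ≡⟨ q^*-shift m f n ⟩
  f n                             ∎

q^*-order : ∀ m f → q ^ m * f ≈[ m ] 𝟘
q^*-order m f n n<m = trans (*-comm (q ^ m) f n) (≈-*-zeroʳ f (^-order q-order m) n n<m)

-- Infinite sums and inverses.

-- Summands with n < k ≤ N do not reach coefficient n. A bound independent of n makes the sum a
-- single finite sum in the truncated ring.
∑∞-truncate : ∀ N {f} → (∀ k → f k ≈[ k ] 𝟘) → ∑∞ f ≈[ suc N ] (λ n → ∑≤ N (λ k → f k n))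
∑∞-truncate N {f} f≈0 n (s≤s n≤N) = sym (begin
  ∑≤ N (λ k → f k n)             ≡⟨ cong (λ i → ∑≤ i (λ k → f k n)) (ℕ.m∸n+n≡m n≤N) ⟨
  ∑≤ (N ∸ n ℕ.+ n) (λ k → f k n) ≡⟨ ∑≤-extend (N ∸ n) (λ k n<k → f≈0 k n n<k) ⟩
  ∑≤ n (λ k → f k n)             ∎)

-- With f = 1 - g this is (1 - g) ∑_{k ≤ K} gᵏ = 1 - gᴷ⁺¹.
geometric-telescope : ∀ f K n → (f * (λ i → ∑≤ K (λ k → ((𝟙 - f) ^ k) i))) n ≡ (𝟙 - (𝟙 - f) ^ suc K) n
geometric-telescope f K n = go K
  where
  g = 𝟙 - f
  S : ℕ → PowerSeries
  S K i = ∑≤ K (λ k → (g ^ k) i)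
  f≗1-g : f ≗ 𝟙 - g
  f≗1-g i = solveℤ 2 (λ x y → y ≔ x ⊞ ⊟ (x ⊞ ⊟ y)) refl (𝟙 i) (f i)
  f*h : ∀ h → (f * h) n ≡ h n ℤ.- (g * h) n
  f*h h = begin
    (f * h) n                     ≡⟨ *-≗ʳ h f≗1-g n ⟩
    ((𝟙 - g) * h) n               ≡⟨ *-distribʳ-+ h 𝟙 (- g) n ⟩
    (𝟙 * h) n ℤ.+ ((- g) * h) n   ≡⟨ cong₂ ℤ._+_ (*-identityˡ h n) (neg-*ˡ g h n) ⟩
    h n ℤ.- (g * h) n             ∎
  go : ∀ K → (f * S K) n ≡ (𝟙 - g ^ suc K) n
  go zero    = f*h 𝟙
  go (suc K) = begin
    (f * (S K + g ^ suc K)) n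
      ≡⟨ CommutativeRing.distribˡ (truncatedRing (suc n)) f (S K) (g ^ suc K) n ℕ.≤-refl ⟩
    (f * S K) n ℤ.+ (f * g ^ suc K) n ≡⟨ cong₂ ℤ._+_ (go K) (f*h (g ^ suc K)) ⟩
    (𝟙 n ℤ.- (g ^ suc K) n) ℤ.+ ((g ^ suc K) n ℤ.- (g ^ suc (suc K)) n)
      ≡⟨ solveℤ 3 (λ a b c → (a ⊞ ⊟ b) ⊞ (b ⊞ ⊟ c)
            ≔ a ⊞ ⊟ c) refl (𝟙 n) ((g ^ suc K) n) ((g ^ suc (suc K)) n) ⟩
    (𝟙 - g ^ suc (suc K)) n ∎

-- The constant term of 1 - f is 0, so the remainder (1 - f)ⁿ⁺¹ left by telescoping has no qⁿ term.
1/-inverseʳ : ∀ f → f 0 ≡ 1ℤ → f * 1/ f ≗ 𝟙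
1/-inverseʳ f f0≡1 n = begin
  (f * 1/ f) n
    ≡⟨ *-cong {suc n} {f} (λ _ _ → refl) (∑∞-truncate n (^-order g-order)) n ℕ.≤-refl ⟩
  (f * (λ i → ∑≤ n (λ k → (g ^ k) i))) n ≡⟨ geometric-telescope f n n ⟩
  𝟙 n ℤ.- (g ^ suc n) n     ≡⟨ cong (λ z → 𝟙 n ℤ.- z) (^-order g-order (suc n) n ℕ.≤-refl) ⟩
  𝟙 n ℤ.+ 0ℤ                ≡⟨ ℤ.+-identityʳ _ ⟩
  𝟙 n                       ∎
  where
  g = 𝟙 - f
  g-order : g ≈[ 1 ] 𝟘
  g-order zero _ = trans (cong (λ z → 1ℤ ℤ.- z) f0≡1) refl
  g-order (suc n) (s≤s ())

-- Evaluating f g (1/f) in two ways identifies a series that inverts f only modulo qᴺ with a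
-- truncation of `1/ f`.
1/-unique : ∀ {N} f {g} → f 0 ≡ 1ℤ → f * g ≈[ N ] 𝟙 → 1/ f ≈[ N ] g
1/-unique {N} f {g} f0≡1 fg≈1 n n<N = begin
  (1/ f) n           ≡⟨ *-identityˡ (1/ f) n ⟨
  (𝟙 * 1/ f) n       ≡⟨ *-congʳ {1/ f} fg≈1 n n<N ⟨
  (f * g * 1/ f) n   ≡⟨ *-congʳ {1/ f} {f * g} {g * f} (λ i _ → *-comm f g i) n n<N ⟩
  (g * f * 1/ f) n   ≡⟨ *-assoc g f (1/ f) n ⟩
  (g * (f * 1/ f)) n ≡⟨ *-≗ˡ g (1/-inverseʳ f f0≡1) n ⟩
  (g * 𝟙) n          ≡⟨ *-identityʳ g n ⟩
  g n                ∎
  where open CommutativeRing (truncatedRing N) using (*-congʳ)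

-- Truncation of infinite products.

⟨⨾⟩-suc : ∀ x b → b ≈[ 1 ] 𝟘 → ∀ k → ⟨ x ⨾ b ⟩ suc k ≈[ k ] ⟨ x ⨾ b ⟩ k
⟨⨾⟩-suc x b b≈0 k n n<k = begin
  (⟨ x ⨾ b ⟩ k * (𝟙 - x * b ^ k)) n ≡⟨ *-congˡ {⟨ x ⨾ b ⟩ k} factor n n<k ⟩
  (⟨ x ⨾ b ⟩ k * 𝟙) n               ≡⟨ *-identityʳ (⟨ x ⨾ b ⟩ k) n ⟩
  (⟨ x ⨾ b ⟩ k) n                   ∎
  where
  open CommutativeRing (truncatedRing k) using (*-congˡ)
  factor : 𝟙 - x * b ^ k ≈[ k ] 𝟙
  factor i i<k = trans (cong (λ z → 𝟙 i ℤ.- z) (≈-*-zeroʳ x (^-order b≈0 k) i i<k)) (ℤ.+-identityʳ (𝟙 i))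

⟨⨾⟩-stable : ∀ x b → b ≈[ 1 ] 𝟘 → ∀ m k → ⟨ x ⨾ b ⟩ (m ℕ.+ k) ≈[ k ] ⟨ x ⨾ b ⟩ k
⟨⨾⟩-stable x b b≈0 zero    k n n<k = refl
⟨⨾⟩-stable x b b≈0 (suc m) k n n<k =
  trans (⟨⨾⟩-suc x b b≈0 (m ℕ.+ k) n (ℕ.m≤n⇒m≤o+n m n<k)) (⟨⨾⟩-stable x b b≈0 m k n n<k)

-- One finite product serves all coefficients below N, whereas the definition takes a different
-- product for each coefficient.
⟨⨾⟩∞-truncate : ∀ x b → b ≈[ 1 ] 𝟘 → ∀ N → ⟨ x ⨾ b ⟩∞ ≈[ N ] ⟨ x ⨾ b ⟩ N
⟨⨾⟩∞-truncate x b b≈0 N n n<N = sym (begin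
  (⟨ x ⨾ b ⟩ N) n                        ≡⟨ cong (λ k → (⟨ x ⨾ b ⟩ k) n) (ℕ.m∸n+n≡m n<N) ⟨
  (⟨ x ⨾ b ⟩ (N ∸ suc n ℕ.+ suc n)) n    ≡⟨ ⟨⨾⟩-stable x b b≈0 (N ∸ suc n) (suc n) n ℕ.≤-refl ⟩
  (⟨ x ⨾ b ⟩ suc n) n                    ∎)

⟨⨾⟩-constant : ∀ x b → x ≈[ 1 ] 𝟘 → ∀ k → (⟨ x ⨾ b ⟩ k) 0 ≡ 1ℤ
⟨⨾⟩-constant x b x≈0 zero    = refl
⟨⨾⟩-constant x b x≈0 (suc k) = begin
  (⟨ x ⨾ b ⟩ k) 0 ℤ.* (1ℤ ℤ.- x 0 ℤ.* (b ^ k) 0)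
    ≡⟨ cong₂ (λ y z → y ℤ.* (1ℤ ℤ.- z ℤ.* (b ^ k) 0)) (⟨⨾⟩-constant x b x≈0 k) (x≈0 0 (s≤s z≤n)) ⟩
  1ℤ                                             ∎

-- The series 1/(1 - qⁱ) and 1/(q²; q²)ₖ.

u P : ℕ → PowerSeries
u i = 1/ (𝟙 - q ^ i)
P k = 1/ (⟨ q ^ 2 ⨾ q ^ 2 ⟩ k)

1-q^-inverse : ∀ i → (𝟙 - q ^ suc i) * u (suc i) ≗ 𝟙
1-q^-inverse i = 1/-inverseʳ (𝟙 - q ^ suc i) (cong (λ z → 1ℤ ℤ.- z) (^-order q-order (suc i) 0 (s≤s z≤n)))

u-geometric : ∀ i → u (suc i) ≗ 𝟙 + q ^ suc i * u (suc i)
u-geometric i n = 1-*-fixpoint (truncatedRing (suc n)) (q ^ suc i) (u (suc i)) (λ k _ → 1-q^-inverse i k) n ℕ.≤-refl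

-- The equation solved by a generating function whose objects may be extended by any number of parts
-- of size i + 1; see `gf-chain-fixpoint`.
u-fixpoint : ∀ i f → f + q ^ suc i * (u (suc i) * f) ≗ u (suc i) * f
u-fixpoint i f n = sym (begin
  (u (suc i) * f) n                          ≡⟨ *-≗ʳ f (u-geometric i) n ⟩
  ((𝟙 + q ^ suc i * u (suc i)) * f) n        ≡⟨ *-distribʳ-+ f 𝟙 (q ^ suc i * u (suc i)) n ⟩
  (𝟙 * f) n ℤ.+ (q ^ suc i * u (suc i) * f) n
    ≡⟨ cong₂ ℤ._+_ (*-identityˡ f n) (*-assoc (q ^ suc i) (u (suc i)) f n) ⟩
  f n ℤ.+ (q ^ suc i * (u (suc i) * f)) n    ∎)

q²-power : ∀ k → q ^ 2 * (q ^ 2) ^ k ≗ q ^ (2 ℕ.* suc k)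
q²-power k = ^-* q 2 (suc k)

q²-order : q ^ 2 ≈[ 1 ] 𝟘
q²-order = ≈-weaken (s≤s z≤n) (^-order q-order 2)

⟨q²⟩-inverse : ∀ k → ⟨ q ^ 2 ⨾ q ^ 2 ⟩ k * P k ≗ 𝟙
⟨q²⟩-inverse k = 1/-inverseʳ (⟨ q ^ 2 ⨾ q ^ 2 ⟩ k) (⟨⨾⟩-constant (q ^ 2) (q ^ 2) q²-order k)

-- Enumerations of lists of parts by weight.

⇔-×ˡ : ∀ {S T : Pred (List Part) 0ℓ} {n} → (∀ π → S π ⇔ T π) →
       ∀ π → (S π × weight π ≡ n) ⇔ (T π × weight π ≡ n)
⇔-×ˡ S⇔T π = mk⇔ (λ (s , w) → to (S⇔T π) s , w) (λ (t , w) → from (S⇔T π) t , w)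

-- A single coefficient of `GeneratingFunction`, so that strong induction on the weight is possible.
Enumerates : Pred (List Part) 0ℓ → ℕ → ℤ → Set
Enumerates S n k = Σ[ xs ∈ List (List Part) ]
  Unique xs × (∀ π → π ∈ xs ⇔ (S π × weight π ≡ n)) × + length xs ≡ k

module _ {S T : Pred (List Part) 0ℓ} {n : ℕ} where

  enumerates-resp : (∀ π → (S π × weight π ≡ n) ⇔ (T π × weight π ≡ n)) →
                    ∀ {k l} → k ≡ l → Enumerates S n k → Enumerates T n l
  enumerates-resp S⇔T k≡l (xs , unique , spec , len) =
    xs , unique , (λ π → ⇔-trans (spec π) (S⇔T π)) , trans len k≡l

  enumerates-∪ : (∀ {π} → S π → ¬ T π) → ∀ {k l} →
                  Enumerates S n k → Enumerates T n l → Enumerates (S ∪ T) n (k ℤ.+ l)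
  enumerates-∪ disjoint (xs , xs! , xs-spec , xs-len) (ys , ys! , ys-spec , ys-len) =
    xs ++ ys
    , Unique.++⁺ xs! ys! (λ {π} (∈xs , ∈ys) → disjoint (proj₁ (to (xs-spec π) ∈xs)) (proj₁ (to (ys-spec π) ∈ys)))
    , (λ π → mk⇔
        ([ (λ ∈xs → let s , w = to (xs-spec π) ∈xs in inj₁ s , w)
         , (λ ∈ys → let t , w = to (ys-spec π) ∈ys in inj₂ t , w) ]′ ∘ ∈-++⁻ xs)
        λ { (inj₁ s , w) → ∈-++⁺ˡ (from (xs-spec π) (s , w))
          ; (inj₂ t , w) → ∈-++⁺ʳ xs (from (ys-spec π) (t , w)) })
    , trans (cong +_ (length-++ xs)) (trans (ℤ.pos-+ (length xs) (length ys)) (cong₂ ℤ._+_ xs-len ys-len))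

-- Two lists without repetition and with the same members are permutations of each other.
enumerates-unique : ∀ {S n k l} → Enumerates S n k → Enumerates S n l → k ≡ l
enumerates-unique (xs , xs! , xs-spec , xs-len) (ys , ys! , ys-spec , ys-len) =
  trans (sym xs-len) (trans (cong +_ (↭-length (∼bag⇒↭ (unique∧set⇒bag xs! ys!
    (λ {π} → ⇔-trans (xs-spec π) (⇔-sym (ys-spec π))))))) ys-len)

-- Filtering produces the list. Its length follows by difference: kept and rejected elements
-- together enumerate S, and counts are unique.
enumerates-∩ : ∀ {S P n k l} → Decidable P → Enumerates S n k → Enumerates (S ∩ ∁ P) n l →
               Enumerates (S ∩ P) n (k ℤ.- l)
enumerates-∩ {S} {P} {n} {k} {l} P? whole@(xs , xs! , xs-spec , _) rejected =
  enumerates-resp (λ _ → mk⇔ id id) m≡k-l rest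
  where
  rest : Enumerates (S ∩ P) n (+ length (filter P? xs))
  rest = filter P? xs , Unique.filter⁺ P? xs!
    , (λ π → mk⇔
        (λ ∈ys → let ∈xs , p = ∈-filter⁻ P? {xs = xs} ∈ys
                     s , w = to (xs-spec π) ∈xs in (s , p) , w)
        (λ ((s , p) , w) → ∈-filter⁺ P? (from (xs-spec π) (s , w)) p))
    , refl
  cover : ∀ π → ((S ∩ ∁ P) ∪ (S ∩ P)) π ⇔ S π
  cover π = mk⇔ [ proj₁ , proj₁ ]′ λ s → case P? π of λ
    { (yes p) → inj₂ (s , p) ; (no ¬p) → inj₁ (s , ¬p) }
  m = + length (filter P? xs)
  m≡k-l : m ≡ k ℤ.- l
  m≡k-l = begin
    m                 ≡⟨ ℤ.+-identityˡ m ⟨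
    0ℤ ℤ.+ m          ≡⟨ cong (ℤ._+ m) (ℤ.+-inverseʳ l) ⟨
    l ℤ.- l ℤ.+ m     ≡⟨ ℤ.+-assoc l (ℤ.- l) m ⟩
    l ℤ.+ (ℤ.- l ℤ.+ m) ≡⟨ cong (λ z → l ℤ.+ z) (ℤ.+-comm (ℤ.- l) m) ⟩
    l ℤ.+ (m ℤ.- l)   ≡⟨ ℤ.+-assoc l m (ℤ.- l) ⟨
    l ℤ.+ m ℤ.- l     ≡⟨ cong (ℤ._- l) (enumerates-unique
                           (enumerates-resp (⇔-×ˡ cover) refl (enumerates-∪ (λ (_ , ¬p) (_ , p) → ¬p p) rejected rest)) whole) ⟩
    k ℤ.- l           ∎

Prefixed : Part → Pred (List Part) 0ℓ → Pred (List Part) 0ℓ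
Prefixed p T []      = ⊥
Prefixed p T (r ∷ π) = r ≡ p × T π

-- Prepending p shifts weights by `size p`. Only the tails of weight n - size p have to be
-- enumerated, which strong induction on n can supply.
enumerates-∷ : ∀ p {T} f n → (∀ m → size p ℕ.+ m ≡ n → Enumerates T m (f m)) →
               Enumerates (Prefixed p T) n ((q ^ size p * f) n)
enumerates-∷ p {T} f n enum with ℕ.<-≤-connex n (size p)
... | inj₁ n<p = [] , [] , (λ π → mk⇔ (λ ()) (impossible π)) , sym (q^*-order (size p) f n n<p)
  where
  impossible : ∀ π → Prefixed p T π × weight π ≡ n → π ∈ []
  impossible (_ ∷ π) ((refl , _) , refl) = contradiction (ℕ.m≤m+n (size p) (weight π)) (ℕ.<⇒≱ n<p)
... | inj₂ p≤n with enum (n ∸ size p) (ℕ.m+[n∸m]≡n p≤n)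
... | xs , xs! , xs-spec , xs-len =
  map (p ∷_) xs
  , Unique.map⁺ ∷-injectiveʳ xs!
  , (λ π → mk⇔ sound (complete π))
  , (begin
    + length (map (p ∷_) xs)                      ≡⟨ cong +_ (length-map (p ∷_) xs) ⟩
    + length xs                                   ≡⟨ xs-len ⟩
    f (n ∸ size p)                                ≡⟨ q^*-shift (size p) f (n ∸ size p) ⟨
    (q ^ size p * f) (size p ℕ.+ (n ∸ size p))    ≡⟨ cong (q ^ size p * f) (ℕ.m+[n∸m]≡n p≤n) ⟩
    (q ^ size p * f) n                            ∎)
  where
  sound : ∀ {π} → π ∈ map (p ∷_) xs → Prefixed p T π × weight π ≡ n
  sound ∈map with ∈-map⁻ (p ∷_) ∈map
  ... | π′ , ∈xs , refl = let t , w = to (xs-spec π′) ∈xs in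
    (refl , t) , trans (cong (size p ℕ.+_) w) (ℕ.m+[n∸m]≡n p≤n)
  complete : ∀ π → Prefixed p T π × weight π ≡ n → π ∈ map (p ∷_) xs
  complete (_ ∷ π) ((refl , t) , refl) =
    ∈-map⁺ (p ∷_) (from (xs-spec π) (t , sym (ℕ.m+n∸m≡n (size p) (weight π))))

-- Chains and their decomposition by the first part.

-- p ≽ p′ when p may precede p′ in an overpartition whose non-overlined parts
-- are at least as large as its overlined parts.
record _≽_ (p p′ : Part) : Set where
  constructor mk≽
  field
    size-≥     : size p ≥ size p′
    overlined  : Overlined p′ → size p ≢ size p′
    separation : Overlined p → NonOverlined p′ → size p ≤ size p′
open _≽_

-- All pairs are compared because `_≽_` is not transitive: in overlined 3, overlined 2, plain 2 the
-- neighbours are related but the outer parts are not.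
Chain : Pred Part 0ℓ → Pred (List Part) 0ℓ
Chain C π = All C π × AllPairs _≽_ π

-- The nonempty chains of parts in C that start with p have a tail in Chain T,
-- and all other chains of parts in C lie in Chain C′.
record Splits (C C′ : Pred Part 0ℓ) (p : Part) (T : Pred Part 0ℓ) : Set where
  field
    split  : ∀ {r} → C r → r ≡ p ⊎ C′ r
    p∈C    : C p
    C′⊆C   : C′ ⊆ C
    p∉C′   : ¬ C′ p
    C′⋡p   : ∀ {r} → C′ r → ¬ r ≽ p
    T⇒C    : T ⊆ C
    T⇒≽    : ∀ {r} → T r → p ≽ r
    C∧≽⇒T  : ∀ {r} → C r → p ≽ r → T r

  disjoint : ∀ {π} → Chain C′ π → ¬ Prefixed p (Chain T) π
  disjoint {_ ∷ _} (p∈C′ ∷ _ , _) (refl , _) = p∉C′ p∈C′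

  -- A chain in C starts with p or avoids p altogether: a head in C′ cannot precede p, so `split`
  -- puts the whole tail into C′.
  chain⇔ : ∀ π → (Chain C′ ∪ Prefixed p (Chain T)) π ⇔ Chain C π
  chain⇔ π = mk⇔ (join π) (separate π)
    where
    join : ∀ π → (Chain C′ ∪ Prefixed p (Chain T)) π → Chain C π
    join π       (inj₁ (cs , ps))        = All.map C′⊆C cs , ps
    join (_ ∷ π) (inj₂ (refl , ts , ps)) = p∈C ∷ All.map T⇒C ts , All.map T⇒≽ ts ∷ ps
    separate : ∀ π → Chain C π → (Chain C′ ∪ Prefixed p (Chain T)) π
    separate []      _                       = inj₁ ([] , [])
    separate (r ∷ π) (c ∷ cs , r≽ ∷ ps) with split c
    ... | inj₁ refl = inj₂ (refl , All.zipWith (λ (c , r) → C∧≽⇒T c r) (cs , r≽) , ps)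
    ... | inj₂ c′   = inj₁ (c′ ∷ All.zipWith rest (cs , r≽) , r≽ ∷ ps)
      where
      rest : ∀ {s} → C s × r ≽ s → C′ s
      rest (c , r≽s) with split c
      ... | inj₁ refl = contradiction r≽s (C′⋡p c′)
      ... | inj₂ c″   = c″

gf-chain : ∀ {C C′ T p f g} → Splits C C′ p T →
           GeneratingFunction (Chain C′) weight f → GeneratingFunction (Chain T) weight g →
           GeneratingFunction (Chain C) weight (f + q ^ size p * g)
gf-chain {p = p} {g = g} s gfC′ gfT n = enumerates-resp (⇔-×ˡ chain⇔) refl
  (enumerates-∪ disjoint (gfC′ n) (enumerates-∷ p g n (λ m _ → gfT m)))
  where open Splits s

-- The case T = C, in which p may be repeated. Tails are again chains in C, of smaller weight
-- because `size p` is positive.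
gf-chain-fixpoint : ∀ {C C′ p f g} → 0 < size p → Splits C C′ p C → f + q ^ size p * g ≗ g →
                    GeneratingFunction (Chain C′) weight f → GeneratingFunction (Chain C) weight g
gf-chain-fixpoint {p = p} {g = g} 0<p s g≗ gfC′ = <-rec _ λ n enum →
  enumerates-resp (⇔-×ˡ chain⇔) (g≗ n) (enumerates-∪ disjoint (gfC′ n)
    (enumerates-∷ p g n (λ m p+m≡n → enum (subst (m <_) p+m≡n (ℕ.+-monoˡ-≤ m 0<p)))))
  where open Splits s

-- Parts of size at most m and their possible successors.

record Bounded (m : ℕ) (r : Part) : Set where
  constructor bounds
  field
    size-positive : 0 < size r
    size-≤        : size r ≤ m
open Bounded

-- After an overlined m + 1, separation permits no plain part other than m + 1, and overlined parts
-- must be smaller.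
AfterOverlined : ℕ → Pred Part 0ℓ
AfterOverlined m r = r ≡ part (suc m) false ⊎ (Bounded m ∩ Overlined) r

-- After a plain m + 1, an overlined m + 1 would not be a first occurrence. Chains in this class are
-- also the bounded chains that avoid the overlined m + 1.
AfterNonOverlined : ℕ → Pred Part 0ℓ
AfterNonOverlined m r = Bounded (suc m) r × r ≢ part (suc m) true

bounded-suc : ∀ {m r} → Bounded (suc m) r → size r ≡ suc m ⊎ Bounded m r
bounded-suc (bounds 0<r r≤1+m) = Sum.map₂ (λ r<1+m → bounds 0<r (s≤s⁻¹ r<1+m)) (Sum.swap (ℕ.m≤n⇒m<n∨m≡n r≤1+m))

bounded-mono : ∀ {m r} → Bounded m r → Bounded (suc m) r
bounded-mono (bounds 0<r r≤m) = bounds 0<r (ℕ.m≤n⇒m≤1+n r≤m)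

suc-bounded : ∀ {m o} → Bounded (suc m) (part (suc m) o)
suc-bounded = bounds (s≤s z≤n) ℕ.≤-refl

suc-unbounded : ∀ {m o} → ¬ Bounded m (part (suc m) o)
suc-unbounded b = ℕ.1+n≰n (size-≤ b)

bounded-⋡ : ∀ {m r o} → Bounded m r → ¬ r ≽ part (suc m) o
bounded-⋡ b r≽ = ℕ.<⇒≱ (s≤s (size-≤ b)) (size-≥ r≽)

overlined-≽ : ∀ {m o r} → (Bounded m ∩ Overlined) r → part (suc m) o ≽ r
overlined-≽ (bounds _ r≤m , r-over) = mk≽ (ℕ.m≤n⇒m≤1+n r≤m)
  (λ _ 1+m≡r → ℕ.<⇒≢ (s≤s r≤m) (sym 1+m≡r))
  (λ _ r-non → contradiction (trans (sym r-over) r-non) λ ())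

nonOverlined-≽ : ∀ {m r} → AfterNonOverlined m r → part (suc m) false ≽ r
nonOverlined-≽ (bounds _ r≤1+m , r≢) = mk≽ r≤1+m (λ { refl refl → r≢ refl }) λ ()

module _ (m : ℕ) where

  overlined-split : ∀ {r} → (Bounded (suc m) ∩ Overlined) r → r ≡ part (suc m) true ⊎ (Bounded m ∩ Overlined) r
  overlined-split (b , refl) with bounded-suc b
  ... | inj₁ refl = inj₁ refl
  ... | inj₂ b′   = inj₂ (b′ , refl)

  overlined-⇒ : ∀ {r} → (Bounded (suc m) ∩ Overlined) r → part (suc m) true ≽ r → (Bounded m ∩ Overlined) r
  overlined-⇒ c@(_ , over) ≽r with overlined-split c
  ... | inj₁ refl = contradiction refl (overlined ≽r over)
  ... | inj₂ c′   = c′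

  nonOverlined-split : ∀ {r} → AfterNonOverlined m r → r ≡ part (suc m) false ⊎ Bounded m r
  nonOverlined-split {part _ o} (b , r≢) with bounded-suc b
  nonOverlined-split {part _ true}  (b , r≢) | inj₁ refl = contradiction refl r≢
  nonOverlined-split {part _ false} (b , r≢) | inj₁ refl = inj₁ refl
  ... | inj₂ b′ = inj₂ b′

  bounded-split : ∀ {r} → Bounded (suc m) r → r ≡ part (suc m) true ⊎ AfterNonOverlined m r
  bounded-split {part t false} b = inj₂ (b , λ ())
  bounded-split {part t true}  b with t ℕ.≟ suc m
  ... | yes refl = inj₁ refl
  ... | no t≢    = inj₂ (b , λ { refl → t≢ refl })

  afterOverlined-⇒ : ∀ {r} → AfterOverlined m r → Bounded (suc m) r × part (suc m) true ≽ r
  afterOverlined-⇒ (inj₁ refl)      = suc-bounded , mk≽ ℕ.≤-refl (λ ()) (λ _ _ → ℕ.≤-refl)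
  afterOverlined-⇒ (inj₂ c@(b , _)) = bounded-mono b , overlined-≽ c

  ⇒-afterOverlined : ∀ {r} → Bounded (suc m) r → part (suc m) true ≽ r → AfterOverlined m r
  ⇒-afterOverlined {part t true}  b ≽r = inj₂ (overlined-⇒ (b , refl) ≽r)
  ⇒-afterOverlined {part t false} (bounds _ t≤1+m) ≽r =
    inj₁ (cong (λ s → part s false) (ℕ.≤-antisym t≤1+m (separation ≽r refl refl)))

  nonOverlined-⋡ : ∀ {r} → AfterNonOverlined m r → ¬ r ≽ part (suc m) true
  nonOverlined-⋡ (bounds _ r≤1+m , _) r≽ = overlined r≽ refl (ℕ.≤-antisym r≤1+m (size-≥ r≽))

-- Splitting by the largest part, and the resulting recurrences.

gf-empty : ∀ {C : Pred Part 0ℓ} → (∀ {r} → ¬ C r) → GeneratingFunction (Chain C) weight 𝟙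
gf-empty C-empty zero = [] ∷ [] , [] ∷ []
  , (λ π → mk⇔ (λ { (here refl) → ([] , []) , refl })
      λ { (([] , _) , _) → here refl ; ((c ∷ _ , _) , _) → contradiction c C-empty })
  , refl
gf-empty C-empty (suc n) = [] , []
  , (λ π → mk⇔ (λ ()) λ { (([] , _) , ()) ; ((c ∷ _ , _) , _) → contradiction c C-empty })
  , refl

overlined-splits : ∀ m → Splits (Bounded (suc m) ∩ Overlined) (Bounded m ∩ Overlined)
                                (part (suc m) true) (Bounded m ∩ Overlined)
overlined-splits m = record
  { split = overlined-split m ; p∈C = suc-bounded , refl
  ; C′⊆C = λ (b , o) → bounded-mono b , o ; p∉C′ = suc-unbounded ∘ proj₁ ; C′⋡p = bounded-⋡ ∘ proj₁
  ; T⇒C = λ (b , o) → bounded-mono b , o ; T⇒≽ = overlined-≽ ; C∧≽⇒T = overlined-⇒ m }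

afterOverlined-splits : ∀ m → Splits (AfterOverlined m) (Bounded m ∩ Overlined)
                                     (part (suc m) false) (AfterOverlined m)
afterOverlined-splits m = record
  { split = λ c → c ; p∈C = inj₁ refl
  ; C′⊆C = inj₂ ; p∉C′ = suc-unbounded ∘ proj₁ ; C′⋡p = bounded-⋡ ∘ proj₁
  ; T⇒C = λ c → c ; C∧≽⇒T = λ c _ → c
  ; T⇒≽ = λ { (inj₁ refl) → mk≽ ℕ.≤-refl (λ ()) λ () ; (inj₂ c) → overlined-≽ c } }

afterNonOverlined-splits : ∀ m → Splits (AfterNonOverlined m) (Bounded m)
                                        (part (suc m) false) (AfterNonOverlined m)
afterNonOverlined-splits m = record
  { split = nonOverlined-split m ; p∈C = suc-bounded , λ ()
  ; C′⊆C = λ b → bounded-mono b , λ { refl → suc-unbounded b } ; p∉C′ = suc-unbounded ; C′⋡p = bounded-⋡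
  ; T⇒C = λ c → c ; T⇒≽ = nonOverlined-≽ ; C∧≽⇒T = λ c _ → c }

bounded-splits : ∀ m → Splits (Bounded (suc m)) (AfterNonOverlined m)
                              (part (suc m) true) (AfterOverlined m)
bounded-splits m = record
  { split = bounded-split m ; p∈C = suc-bounded
  ; C′⊆C = proj₁ ; p∉C′ = λ (_ , r≢) → r≢ refl ; C′⋡p = nonOverlined-⋡ m
  ; T⇒C = proj₁ ∘ afterOverlined-⇒ m ; T⇒≽ = proj₂ ∘ afterOverlined-⇒ m ; C∧≽⇒T = ⇒-afterOverlined m }

-- This is (-q; q)ₘ, split by whether the overlined m + 1 occurs.
D : ℕ → PowerSeries
D zero    = 𝟙
D (suc m) = D m + q ^ suc m * D m

-- In the first summand the overlined m + 1 is absent, and plain copies of m + 1 precede a chain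
-- bounded by m. In the second it comes first, followed by plain copies and then smaller overlined
-- parts.
W : ℕ → PowerSeries
W zero    = 𝟙
W (suc m) = u (suc m) * W m + q ^ suc m * (u (suc m) * D m)

gf-overlined : ∀ m → GeneratingFunction (Chain (Bounded m ∩ Overlined)) weight (D m)
gf-overlined zero    = gf-empty λ (bounds 0<r r≤0 , _) → ℕ.<⇒≱ 0<r r≤0
gf-overlined (suc m) = gf-chain (overlined-splits m) (gf-overlined m) (gf-overlined m)

gf-bounded : ∀ m → GeneratingFunction (Chain (Bounded m)) weight (W m)
gf-bounded zero    = gf-empty λ (bounds 0<r r≤0) → ℕ.<⇒≱ 0<r r≤0
gf-bounded (suc m) = gf-chain (bounded-splits m)
  (gf-chain-fixpoint (s≤s z≤n) (afterNonOverlined-splits m) (u-fixpoint m (W m)) (gf-bounded m))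
  (gf-chain-fixpoint (s≤s z≤n) (afterOverlined-splits m) (u-fixpoint m (D m)) (gf-overlined m))

-- Chains as overpartitions.

nonOverlined? : Decidable NonOverlined
nonOverlined? r = isOverlined r Bool.≟ false

overlined⇒¬nonOverlined : ∀ {r} → Overlined r → ¬ NonOverlined r
overlined⇒¬nonOverlined refl ()

chain⇒𝓔ᴺₒ : ∀ {m π} → Chain (Bounded m) π → Any NonOverlined π → 𝓔ᴺₒ π
chain⇒𝓔ᴺₒ {m} {π} (bs , ps) any = record
  { isOverpartition = record
    { positive        = All.map size-positive bs
    ; nonIncreasing   = AllPairs⇒Linked (AllPairs.map⁺ (AllPairs.map size-≥ ps))
    ; firstOccurrence = AllPairs.map overlined ps
    }
  ; hasNonOverlined = any
  ; separated       = separated ps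
  }
  where
  separated : ∀ {π p p′} → AllPairs _≽_ π → p ∈ π → p′ ∈ π → NonOverlined p → Overlined p′ → size p ≥ size p′
  -- When the positions differ, a plain part that comes first uses `size-≥` and an overlined one
  -- uses `separation`.
  separated (_ ∷ _)  (here refl) (here refl) non over = ℕ.≤-refl
  separated (r ∷ _)  (here refl) (there j)   non over = size-≥ (All.lookup r j)
  separated (r ∷ _)  (there i)   (here refl) non over = separation (All.lookup r i) over non
  separated (_ ∷ ps) (there i)   (there j)   non over = separated ps i j non over

-- Identifies the chains counted by `D` with those to be removed at the end.
chain-overlined⇔ : ∀ {m} π → Chain (Bounded m ∩ Overlined) π ⇔ (Chain (Bounded m) ∩ ∁ (Any NonOverlined)) π
chain-overlined⇔ π = mk⇔
  (λ (cs , ps) → (All.map proj₁ cs , ps) , All.All¬⇒¬Any (All.map (λ {r} (_ , over) → overlined⇒¬nonOverlined {r} over) cs))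
  λ ((bs , ps) , ¬any) →
    All.zipWith (λ (b , ¬non) → b , Bool.¬-not ¬non) (bs , All.¬Any⇒All¬ π ¬any) , ps

size≤weight : ∀ π → All (λ r → size r ≤ weight π) π
size≤weight []      = []
size≤weight (r ∷ π) = ℕ.m≤m+n _ _ ∷ All.map (λ s≤ → ℕ.≤-trans s≤ (ℕ.m≤n+m _ (size r))) (size≤weight π)

𝓔ᴺₒ⇒chain : ∀ {m π} → weight π ≤ m → 𝓔ᴺₒ π → Chain (Bounded m) π
𝓔ᴺₒ⇒chain {m} {π} w≤m e =
  All.zipWith (λ (0<r , r≤w) → bounds 0<r (ℕ.≤-trans r≤w w≤m)) (positive , size≤weight π) ,
  AllPairs.zipWith (λ ((ge , first) , sep) → mk≽ ge first sep)
    (AllPairs.zip (AllPairs.map⁻ (Linked⇒AllPairs (λ x≥y y≥z → ℕ.≤-trans y≥z x≥y) nonIncreasing) , firstOccurrence)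
    , separations π (λ i j → separated j i))
  where
  open 𝓔ᴺₒ e
  open IsOverpartition isOverpartition
  Separated : Part → Part → Set
  Separated p p′ = Overlined p → NonOverlined p′ → size p ≤ size p′
  separations : ∀ π → (∀ {p p′} → p ∈ π → p′ ∈ π → NonOverlined p′ → Overlined p → size p ≤ size p′) →
                AllPairs Separated π
  separations []      sep = []
  separations (r ∷ π) sep = All.tabulate (λ i over non → sep (here refl) (there i) non over)
    ∷ separations π (λ i j → sep (there i) (there j))

-- The bound n + 1 admits every overpartition of weight n and is the index N at which the truncated
-- identity holds.
enumerates-𝓔ᴺₒ : ∀ n → Enumerates 𝓔ᴺₒ n (W (suc n) n ℤ.- D (suc n) n)
enumerates-𝓔ᴺₒ n = enumerates-resp
  (λ π → mk⇔ (λ ((c , any) , w) → chain⇒𝓔ᴺₒ c any , w)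
             λ { (e , refl) → (𝓔ᴺₒ⇒chain (ℕ.n≤1+n _) e , 𝓔ᴺₒ.hasNonOverlined e) , refl })
  refl
  (enumerates-∩ (any? nonOverlined?) (gf-bounded N n)
    (enumerates-resp (⇔-×ˡ chain-overlined⇔) refl (gf-overlined N n)))
  where N = suc n

-- Specialisation to power series modulo qⁿ⁺¹.

module _ (n : ℕ) where
  private
    N : ℕ
    N = suc n
    R : CommutativeRing 0ℓ 0ℓ
    R = truncatedRing N
  open CommutativeRing R using (*-congˡ; *-congʳ)
    renaming (refl to ≈-refl; trans to ≈-trans)

  P-zero : P 0 ≈[ N ] 𝟙
  P-zero = 1/-unique 𝟙 {𝟙} refl (λ i _ → *-identityˡ 𝟙 i)

  P-suc : ∀ k → P (suc k) ≈[ N ] u (2 ℕ.* suc k) * P k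
  P-suc k = 1/-unique (⟨ q ^ 2 ⨾ q ^ 2 ⟩ suc k) {u (2 ℕ.* suc k) * P k}
    (⟨⨾⟩-constant (q ^ 2) (q ^ 2) q²-order (suc k))
    (inverse-* R {⟨ q ^ 2 ⨾ q ^ 2 ⟩ k} {P k} {𝟙 - q ^ 2 * (q ^ 2) ^ k} {u (2 ℕ.* suc k)}
      (λ i _ → ⟨q²⟩-inverse k i) (λ i _ → (begin
      ((𝟙 - q ^ 2 * (q ^ 2) ^ k) * u (2 ℕ.* suc k)) i
        ≡⟨ *-≗ʳ (u (2 ℕ.* suc k)) (λ j → cong (λ z → 𝟙 j ℤ.- z) (q²-power k j)) i ⟩
      -- The index passed is the predecessor of `2 ℕ.* suc k` as that product unfolds.
      ((𝟙 - q ^ (2 ℕ.* suc k)) * u (2 ℕ.* suc k)) i   ≡⟨ 1-q^-inverse (k ℕ.+ 1 ℕ.* suc k) i ⟩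
      𝟙 i ∎)))

  D≈⟨-q⟩ : ∀ m → D m ≈[ N ] ⟨ - q ⨾ q ⟩ m
  D≈⟨-q⟩ zero    = ≈-refl {𝟙}
  D≈⟨-q⟩ (suc m) i i<N = sym (begin
    (⟨ - q ⨾ q ⟩ m * (𝟙 - (- q) * q ^ m)) i ≡⟨ *-comm (⟨ - q ⨾ q ⟩ m) (𝟙 - (- q) * q ^ m) i ⟩
    ((𝟙 - (- q) * q ^ m) * ⟨ - q ⨾ q ⟩ m) i ≡⟨ *-≗ʳ (⟨ - q ⨾ q ⟩ m) factor i ⟩
    ((𝟙 + q ^ suc m) * ⟨ - q ⨾ q ⟩ m) i     ≡⟨ *-distribʳ-+ (⟨ - q ⨾ q ⟩ m) 𝟙 (q ^ suc m) i ⟩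
    (𝟙 * ⟨ - q ⨾ q ⟩ m) i ℤ.+ (q ^ suc m * ⟨ - q ⨾ q ⟩ m) i
      ≡⟨ cong₂ ℤ._+_ (*-identityˡ (⟨ - q ⨾ q ⟩ m) i) refl ⟩
    (⟨ - q ⨾ q ⟩ m) i ℤ.+ (q ^ suc m * ⟨ - q ⨾ q ⟩ m) i
      ≡⟨ cong₂ ℤ._+_ (D≈⟨-q⟩ m i i<N) (*-congˡ {q ^ suc m} (D≈⟨-q⟩ m) i i<N) ⟨
    (D m + q ^ suc m * D m) i ∎)
    where
    factor : 𝟙 - (- q) * q ^ m ≗ 𝟙 + q ^ suc m
    factor j = cong (λ z → 𝟙 j ℤ.+ z) (begin
      ℤ.- ((- q) * q ^ m) j    ≡⟨ cong ℤ.-_ (sym (neg-*ˡ q (q ^ m) j)) ⟨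
      ℤ.- (ℤ.- (q * q ^ m) j)  ≡⟨ ℤ.neg-involutive _ ⟩
      (q * q ^ m) j            ∎)

  -- Since (q; q)ₘ (-q; q)ₘ = (q²; q²)ₘ, the quotient (-q; q)ₘ/(q²; q²)ₘ inverts (q; q)ₘ; factor by
  -- factor this is (1 - a)(1 + a) = 1 - a².
  ⟨q⟩-inverse : ∀ m → ⟨ q ⨾ q ⟩ m * (D m * P m) ≈[ N ] 𝟙
  ⟨q⟩-inverse zero i i<N = begin
    (𝟙 * (𝟙 * P 0)) i ≡⟨ *-identityˡ (𝟙 * P 0) i ⟩
    (𝟙 * P 0) i       ≡⟨ *-identityˡ (P 0) i ⟩
    P 0 i             ≡⟨ P-zero i i<N ⟩
    𝟙 i               ∎
  ⟨q⟩-inverse (suc m) i i<N = begin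
    (⟨ q ⨾ q ⟩ m * (𝟙 - a) * ((D m + a * D m) * P (suc m))) i
      ≡⟨ *-congˡ {⟨ q ⨾ q ⟩ m * (𝟙 - a)} (≈-trans {(D m + a * D m) * P (suc m)} {(D m + a * D m) * (v * P m)}
          {(𝟙 + a) * v * (D m * P m)} (*-congˡ {D m + a * D m} (P-suc m)) (1+-rearrange R a (D m) v (P m))) i i<N ⟩
    (⟨ q ⨾ q ⟩ m * (𝟙 - a) * ((𝟙 + a) * v * (D m * P m))) i
      ≡⟨ inverse-* R {⟨ q ⨾ q ⟩ m} {D m * P m} {𝟙 - a} {(𝟙 + a) * v} (⟨q⟩-inverse m) (difference-of-squares-inverse R a v v≈) i i<N ⟩
    𝟙 i ∎
    where
    a = q ^ suc m
    v = u (2 ℕ.* suc m)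
    v≈ : v ≈[ N ] 𝟙 + a * a * v
    v≈ j _ = trans (u-geometric (m ℕ.+ 1 ℕ.* suc m) j) (cong (λ z → 𝟙 j ℤ.+ z) (*-≗ʳ v q^2m j))
      where
      q^2m : q ^ (2 ℕ.* suc m) ≗ a * a
      q^2m k = trans (cong (λ l → (q ^ (suc m ℕ.+ l)) k) (ℕ.+-identityʳ (suc m))) (^-+ q (suc m) (suc m) k)

  summand : ℕ → PowerSeries
  summand k = q ^ odd k * u (odd k) * P k

  ∑<-coefficient : ∀ (f : ℕ → PowerSeries) K i → ∑< R (suc K) f i ≡ ∑≤ K (λ k → f k i)
  ∑<-coefficient f zero    i = ℤ.+-identityˡ (f 0 i)
  ∑<-coefficient f (suc K) i = cong (ℤ._+ f (suc K) i) (∑<-coefficient f K i)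

  summand-order : ∀ k → summand k ≈[ k ] 𝟘
  summand-order k i i<k = trans (*-assoc (q ^ odd k) (u (odd k)) (P k) i)
    (q^*-order (odd k) (u (odd k) * P k) i (ℕ.<-≤-trans i<k k≤odd))
    where
    k≤odd : k ≤ odd k
    k≤odd = ℕ.≤-trans (ℕ.m≤m+n k _) (ℕ.m≤m+n (2 ℕ.* k) 1)

  W≈ : W N ≈[ N ] D N * ∑< R N summand + D N * P N
  W≈ = TruncatedIdentity.identity R n (q ^_) u P D W
    (≈-refl {𝟙}) (λ i j k _ → ^-+ q i j k) (^-order q-order N) (λ i k _ → u-geometric i k) P-zero P-suc
    (≈-refl {𝟙}) (λ m → ≈-refl {D (suc m)}) (≈-refl {𝟙}) (λ m → ≈-refl {W (suc m)})

  ⟨-q⟩∞≈ : ⟨ - q ⨾ q ⟩∞ ≈[ N ] D N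
  ⟨-q⟩∞≈ i i<N = trans (⟨⨾⟩∞-truncate (- q) q q-order N i i<N) (sym (D≈⟨-q⟩ N i i<N))

  1/⟨q⟩∞≈ : 1/ ⟨ q ⨾ q ⟩∞ ≈[ N ] D N * P N
  -- Coefficient 0 of the infinite product is by definition that of the product with one factor,
  -- hence the argument 1.
  1/⟨q⟩∞≈ = 1/-unique ⟨ q ⨾ q ⟩∞ {D N * P N} (⟨⨾⟩-constant q q q-order 1) (λ i i<N → trans
    (*-congʳ {D N * P N} (⟨⨾⟩∞-truncate q q q-order N) i i<N) (⟨q⟩-inverse N i i<N))

  W-D≡ : W N n ℤ.- D N n ≡
    (⟨ - q ⨾ q ⟩∞ * (∑[ k ≥0] summand k) + 1/ ⟨ q ⨾ q ⟩∞ - ⟨ - q ⨾ q ⟩∞) n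
  W-D≡ = cong₂ ℤ._-_
    (begin
      W N n ≡⟨ W≈ n ℕ.≤-refl ⟩
      (D N * ∑< R N summand + D N * P N) n
        ≡⟨ cong₂ ℤ._+_ (*-cong {N} {⟨ - q ⨾ q ⟩∞} {D N} {∑∞ summand} {∑< R N summand} ⟨-q⟩∞≈ sums n ℕ.≤-refl)
            (1/⟨q⟩∞≈ n ℕ.≤-refl) ⟨
      (⟨ - q ⨾ q ⟩∞ * (∑[ k ≥0] summand k) + 1/ ⟨ q ⨾ q ⟩∞) n ∎)
    (sym (⟨-q⟩∞≈ n ℕ.≤-refl))
    where
    sums : ∑∞ summand ≈[ N ] ∑< R N summand
    sums i i<N = trans (∑∞-truncate n summand-order i i<N) (sym (∑<-coefficient summand n i))

mainTheorem10 : GeneratingFunction 𝓔ᴺₒ weight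
    (⟨ - q ⨾ q ⟩∞
    * (∑[ n ≥0] (q ^ (2 ℕ.* n ℕ.+ 1) * 1/ (𝟙 - q ^ (2 ℕ.* n ℕ.+ 1)) * 1/ (⟨ q ^ 2 ⨾ q ^ 2 ⟩ n)))
    + 1/ ⟨ q ⨾ q ⟩∞
    - ⟨ - q ⨾ q ⟩∞)
mainTheorem10 n = enumerates-resp (λ _ → mk⇔ id id) (W-D≡ n) (enumerates-𝓔ᴺₒ n)
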